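{- For every integer $n>0$ there are $(F,\mathrm{Frob})\in\mathcal{S}$, an element $a_n\in F$ and a tuple $b_n$ from $F$ such that $a_n$ belongs to the definable closure of $b_n$ in $(F,\mathrm{Frob})$ (in the language $\mathcal{L}_\sigma$), but $\deg_\sigma(a_n/b_n)=n$.
   Context: $\mathbb{P}$ = primes, $\mathrm{Frob}_p:x\mapsto x^p$, $\mathcal{L}_\sigma$ = language of rings plus unary $\sigma$. For a parameter-free $\mathcal{L}_\sigma$-formula $\varphi$ and prime $p$, $\varphi_p$ replaces each $\sigma(t)$ by $t^p$. For each ring formula $\psi(x,y)$, $|x|=n$, fix $C_\psi>0$ and finite $D_\psi\subseteq\{0,..,n\}\times\mathbb{R}^{>0}$ such that for all finite fields $\mathbb{F}_q$ and $a$ with $\psi(\mathbb{F}_q^n,a)\ne\emptyset$ some $(d,\mu)\in D_\psi$ has $\big||\psi(\mathbb{F}_q^n,a)|-\mu q^d\big|\le C_\psi q^{d-1/2}$; $E_\psi=\{\mu:(d,\mu)\in D_\psi\}$; $N^p_\varphi=\max\{\mu,1/\mu,2\log_p(2C_{\varphi_p}/\mu):\mu\in E_{\varphi_p}\}$; $f(\ell,p)=\max\{N^p_\varphi:|\varphi|\le\ell\}$. $\mathcal{S}$ = ultraproducts $\prod_{p}(\mathbb{F}_{p^{k_p}},\mathrm{Frob}_p)/\mathcal{U}$, $\mathcal{U}$ non-principal on $\mathbb{P}$, $k_p\ge f(p,p)$. In a difference field, for a difference subfield $E$ and tuple $a$, $\deg_\sigma(a/E)$ is the transcendence degree over $E$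 of the smallest difference field containing $E\cup a$ closed under $\sigma,\sigma^{ -1}$; $\deg_\sigma(a/b)$ means $\deg_\sigma(a/E)$ for $E$ the difference field generated by $b$. -}

module Defs where

open import Algebra.Bundles using (CommutativeRing)
import Algebra.Construct.NaturalChoice.Max as Max
import Algebra.Properties.Semiring.Exp as Exp
import Algebra.Properties.Semiring.Mult as Mult
open import Data.Empty using (⊥)
open import Data.Fin.Base using (Fin; toℕ)
open import Data.List.Base as List
  using (List; []; _∷_; _++_; map; foldr; filter; concatMap; upTo; allFin; cartesianProductWith)
import Data.List.Extrema as Extrema
open import Data.List.Membership.Propositional using (_∈_)
open import Data.List.Membership.Propositional.Properties
  using (∈-++⁺ˡ; ∈-++⁺ʳ; ∈-map⁺; ∈-filter⁺; ∈-cartesianProductWith⁺; ∈-allFin)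
open import Data.List.Relation.Unary.All using (All)
open import Data.List.Relation.Unary.Any using (here; there)
open import Data.Nat.Base as ℕ using (ℕ; zero; suc)
open import Data.Nat.Primality using (Prime)
import Data.Nat.Properties as ℕₚ
open import Data.Product.Base using (Σ; ∃; _×_; _,_; proj₁; proj₂)
open import Data.Refinement using (Refinement; value)
open import Data.Sum.Base using (_⊎_; inj₁; inj₂)
open import Data.Vec.Functional as Vector using (Vector)
import Data.Vec.Functional.Relation.Binary.Equality.Setoid as VecEq
open import Function.Base using (_∘_)
open import Function.Bundles using (Inverse; _⇔_)
open import Level using (0ℓ) renaming (suc to lsuc)
open import Relation.Binary.Bundles using (Setoid; TotalOrder)
open import Relation.Binary.Core using (Rel)
open import Relation.Binary.Structures using (IsTotalOrder)
import Relation.Binary.Construct.On as On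
open import Relation.Binary.PropositionalEquality as ≡ using (_≡_; refl)
open import Relation.Nullary.Negation using (¬_; contradiction)
open import Relation.Unary as Pred using (Pred; _∩_; _∪_; _⊆_; ∁)

-- Only x ⁻¹ for x ≉ 0# is meaningful; the value 0# ⁻¹ is unconstrained.
record Field : Set₁ where
  field
    commutativeRing : CommutativeRing 0ℓ 0ℓ
  open CommutativeRing commutativeRing public
  field
    _⁻¹       : Carrier → Carrier
    *-inverse : ∀ x → ¬ x ≈ 0# → x * x ⁻¹ ≈ 1#
    0≉1       : ¬ 0# ≈ 1#
  open Exp semiring public using (_^_)
  open Mult semiring public using () renaming (_×_ to _·_)

-- The primality proof is irrelevant, so that two elements of ℙ are equal
-- as soon as the underlying numbers are.
ℙ : Set
ℙ = Refinement ℕ Prime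

HasCard : Setoid 0ℓ 0ℓ → ℕ → Set
HasCard S N = Inverse (≡.setoid (Fin N)) S

-- A structure for the language of difference rings whose ring reduct is a
-- field.  That σ is an automorphism is not a component: the members of 𝒮
-- below have it automatically.
record σField : Set₁ where
  field
    baseField : Field
  open Field baseField public
  field
    σ      : Carrier → Carrier
    σ-cong : ∀ {x y} → x ≈ y → σ x ≈ σ y

infixl 6 _⊕_
infixl 7 _⊗_

data RingTerm (v : ℕ) : Set where
  var     : Fin v → RingTerm v
  𝟎 𝟏     : RingTerm v
  ⊖_      : RingTerm v → RingTerm v
  _⊕_ _⊗_ : RingTerm v → RingTerm v → RingTerm v

data σTerm (v : ℕ) : Set where
  var     : Fin v → σTerm v
  𝟎 𝟏     : σTerm v
  ⊖_      : σTerm v → σTerm v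
  σ⟨_⟩    : σTerm v → σTerm v
  _⊕_ _⊗_ : σTerm v → σTerm v → σTerm v

infix  8 _≐_
infixr 6 _∧_
infixr 5 _∨_
infixr 4 _⇒_

-- De Bruijn indices: the free variables are Fin v, and a quantifier binds
-- variable zero of its body.
data Formula (T : ℕ → Set) (v : ℕ) : Set where
  _≐_         : T v → T v → Formula T v
  ~_          : Formula T v → Formula T v
  _∧_ _∨_ _⇒_ : Formula T v → Formula T v → Formula T v
  ∀′ ∃′       : Formula T (suc v) → Formula T v

RingFormula σFormula : ℕ → Set
RingFormula = Formula RingTerm
σFormula    = Formula σTerm

mapTerms : ∀ {S T : ℕ → Set} → (∀ {v} → S v → T v) → ∀ {v} → Formula S v → Formula T v
mapTerms f (s ≐ t) = f s ≐ f t
mapTerms f (~ φ)   = ~ mapTerms f φ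
mapTerms f (φ ∧ ψ) = mapTerms f φ ∧ mapTerms f ψ
mapTerms f (φ ∨ ψ) = mapTerms f φ ∨ mapTerms f ψ
mapTerms f (φ ⇒ ψ) = mapTerms f φ ⇒ mapTerms f ψ
mapTerms f (∀′ φ)  = ∀′ (mapTerms f φ)
mapTerms f (∃′ φ)  = ∃′ (mapTerms f φ)

power : ∀ {v} → RingTerm v → ℕ → RingTerm v
power t zero    = 𝟏
power t (suc k) = t ⊗ power t k

frobTerm : ℕ → ∀ {v} → σTerm v → RingTerm v
frobTerm p (var i) = var i
frobTerm p 𝟎       = 𝟎
frobTerm p 𝟏       = 𝟏
frobTerm p (⊖ t)   = ⊖ frobTerm p t
frobTerm p σ⟨ t ⟩  = power (frobTerm p t) p
frobTerm p (s ⊕ t) = frobTerm p s ⊕ frobTerm p t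
frobTerm p (s ⊗ t) = frobTerm p s ⊗ frobTerm p t

_⟨σ≔Frob_⟩ : ∀ {v} → σFormula v → ℕ → RingFormula v
φ ⟨σ≔Frob p ⟩ = mapTerms (frobTerm p) φ

module Satisfaction {T : ℕ → Set} (S : Setoid 0ℓ 0ℓ)
  (⟦_⟧ : ∀ {v} → T v → Vector (Setoid.Carrier S) v → Setoid.Carrier S) where
  open Setoid S

  Sat : ∀ {v} → Formula T v → Vector Carrier v → Set
  Sat (s ≐ t) ρ = ⟦ s ⟧ ρ ≈ ⟦ t ⟧ ρ
  Sat (~ φ)   ρ = ¬ Sat φ ρ
  Sat (φ ∧ ψ) ρ = Sat φ ρ × Sat ψ ρ
  Sat (φ ∨ ψ) ρ = Sat φ ρ ⊎ Sat ψ ρ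
  Sat (φ ⇒ ψ) ρ = Sat φ ρ → Sat ψ ρ
  Sat (∀′ φ)  ρ = ∀ x → Sat φ (x Vector.∷ ρ)
  Sat (∃′ φ)  ρ = ∃ λ x → Sat φ (x Vector.∷ ρ)

module RingSemantics (K : Field) where
  open Field K

  ⟦_⟧ : ∀ {v} → RingTerm v → Vector Carrier v → Carrier
  ⟦ var i ⟧ ρ = ρ i
  ⟦ 𝟎     ⟧ ρ = 0#
  ⟦ 𝟏     ⟧ ρ = 1#
  ⟦ ⊖ t   ⟧ ρ = - ⟦ t ⟧ ρ
  ⟦ s ⊕ t ⟧ ρ = ⟦ s ⟧ ρ + ⟦ t ⟧ ρ
  ⟦ s ⊗ t ⟧ ρ = ⟦ s ⟧ ρ * ⟦ t ⟧ ρ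

  open Satisfaction setoid ⟦_⟧ public

  Solutions : ∀ n {m} → RingFormula (n ℕ.+ m) → Vector Carrier m → Setoid 0ℓ 0ℓ
  Solutions n ψ a = On.setoid {B = Σ (Vector Carrier n) λ x → Sat ψ (x Vector.++ a)}
                              (VecEq.≋-setoid setoid n) proj₁

module σSemantics (M : σField) where
  open σField M

  ⟦_⟧ : ∀ {v} → σTerm v → Vector Carrier v → Carrier
  ⟦ var i  ⟧ ρ = ρ i
  ⟦ 𝟎      ⟧ ρ = 0#
  ⟦ 𝟏      ⟧ ρ = 1#
  ⟦ ⊖ t    ⟧ ρ = - ⟦ t ⟧ ρ
  ⟦ σ⟨ t ⟩ ⟧ ρ = σ (⟦ t ⟧ ρ)
  ⟦ s ⊕ t  ⟧ ρ = ⟦ s ⟧ ρ + ⟦ t ⟧ ρ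
  ⟦ s ⊗ t  ⟧ ρ = ⟦ s ⟧ ρ * ⟦ t ⟧ ρ

  open Satisfaction setoid ⟦_⟧ public

  _∈dcl_ : ∀ {m} → Carrier → Vector Carrier m → Set
  _∈dcl_ {m} a b = Σ (σFormula (1 ℕ.+ m)) λ φ →
    Sat φ (a Vector.∷ b) × (∀ a′ → Sat φ (a′ Vector.∷ b) → a′ ≈ a)

-- The length of a term or formula is the number of its symbols, without
-- parentheses (a quantifier and the variable it binds count as two).
∣_∣ᵗ : ∀ {v} → σTerm v → ℕ
∣ var i  ∣ᵗ = 1
∣ 𝟎      ∣ᵗ = 1
∣ 𝟏      ∣ᵗ = 1
∣ ⊖ t    ∣ᵗ = suc ∣ t ∣ᵗ
∣ σ⟨ t ⟩ ∣ᵗ = suc ∣ t ∣ᵗ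
∣ s ⊕ t  ∣ᵗ = suc (∣ s ∣ᵗ ℕ.+ ∣ t ∣ᵗ)
∣ s ⊗ t  ∣ᵗ = suc (∣ s ∣ᵗ ℕ.+ ∣ t ∣ᵗ)

∣_∣ᶠ : ∀ {v} → σFormula v → ℕ
∣ s ≐ t ∣ᶠ = suc (∣ s ∣ᵗ ℕ.+ ∣ t ∣ᵗ)
∣ ~ φ   ∣ᶠ = suc ∣ φ ∣ᶠ
∣ φ ∧ ψ ∣ᶠ = suc (∣ φ ∣ᶠ ℕ.+ ∣ ψ ∣ᶠ)
∣ φ ∨ ψ ∣ᶠ = suc (∣ φ ∣ᶠ ℕ.+ ∣ ψ ∣ᶠ)
∣ φ ⇒ ψ ∣ᶠ = suc (∣ φ ∣ᶠ ℕ.+ ∣ ψ ∣ᶠ)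
∣ ∀′ φ  ∣ᶠ = suc (suc ∣ φ ∣ᶠ)
∣ ∃′ φ  ∣ᶠ = suc (suc ∣ φ ∣ᶠ)

termsOfDepth≤ : ℕ → ∀ v → List (σTerm v)
termsOfDepth≤ zero    v = []
termsOfDepth≤ (suc d) v =
  (𝟎 ∷ 𝟏 ∷ map var (allFin v)) ++ map ⊖_ ts ++ map σ⟨_⟩ ts
    ++ cartesianProductWith _⊕_ ts ts ++ cartesianProductWith _⊗_ ts ts
  where ts = termsOfDepth≤ d v

formulasOfDepth≤ : ℕ → ∀ v → List (σFormula v)
formulasOfDepth≤ zero    v = []
formulasOfDepth≤ (suc d) v =
  cartesianProductWith _≐_ ts ts ++ map ~_ φs
    ++ cartesianProductWith _∧_ φs φs ++ cartesianProductWith _∨_ φs φs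
    ++ cartesianProductWith _⇒_ φs φs ++ map ∀′ ψs ++ map ∃′ ψs
  where
  ts = termsOfDepth≤ d v
  φs = formulasOfDepth≤ d v
  ψs = formulasOfDepth≤ d (suc v)

formulasOfLength≤ : ℕ → ∀ v → List (σFormula v)
formulasOfLength≤ ℓ v = filter (λ φ → ∣ φ ∣ᶠ ℕₚ.≤? ℓ) (formulasOfDepth≤ ℓ v)

private
  fst≤ : ∀ {a b d} → a ℕ.+ b ℕ.≤ d → a ℕ.≤ d
  fst≤ {a} = ℕₚ.m+n≤o⇒m≤o a

  snd≤ : ∀ {a b d} → a ℕ.+ b ℕ.≤ d → b ℕ.≤ d
  snd≤ {a} = ℕₚ.m+n≤o⇒n≤o a

∈-termsOfDepth≤ : ∀ {v} d (t : σTerm v) → ∣ t ∣ᵗ ℕ.≤ d → t ∈ termsOfDepth≤ d v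
∈-termsOfDepth≤ (suc d) (var i) _ = ∈-++⁺ˡ (there (there (∈-map⁺ var (∈-allFin i))))
∈-termsOfDepth≤ (suc d) 𝟎 _ = here refl
∈-termsOfDepth≤ (suc d) 𝟏 _ = there (here refl)
∈-termsOfDepth≤ {v} (suc d) (⊖ t) (ℕ.s≤s l) =
  ∈-++⁺ʳ (𝟎 ∷ 𝟏 ∷ map var (allFin v)) (∈-++⁺ˡ (∈-map⁺ ⊖_ (∈-termsOfDepth≤ d t l)))
∈-termsOfDepth≤ {v} (suc d) σ⟨ t ⟩ (ℕ.s≤s l) =
  ∈-++⁺ʳ (𝟎 ∷ 𝟏 ∷ map var (allFin v)) (∈-++⁺ʳ (map ⊖_ ts)
    (∈-++⁺ˡ (∈-map⁺ σ⟨_⟩ (∈-termsOfDepth≤ d t l))))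
  where ts = termsOfDepth≤ d v
∈-termsOfDepth≤ {v} (suc d) (s ⊕ t) (ℕ.s≤s l) =
  ∈-++⁺ʳ (𝟎 ∷ 𝟏 ∷ map var (allFin v)) (∈-++⁺ʳ (map ⊖_ ts) (∈-++⁺ʳ (map σ⟨_⟩ ts)
    (∈-++⁺ˡ (∈-cartesianProductWith⁺ _⊕_
      (∈-termsOfDepth≤ d s (fst≤ l)) (∈-termsOfDepth≤ d t (snd≤ {∣ s ∣ᵗ} l))))))
  where ts = termsOfDepth≤ d v
∈-termsOfDepth≤ {v} (suc d) (s ⊗ t) (ℕ.s≤s l) =
  ∈-++⁺ʳ (𝟎 ∷ 𝟏 ∷ map var (allFin v)) (∈-++⁺ʳ (map ⊖_ ts) (∈-++⁺ʳ (map σ⟨_⟩ ts)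
    (∈-++⁺ʳ (cartesianProductWith _⊕_ ts ts) (∈-cartesianProductWith⁺ _⊗_
      (∈-termsOfDepth≤ d s (fst≤ l)) (∈-termsOfDepth≤ d t (snd≤ {∣ s ∣ᵗ} l))))))
  where ts = termsOfDepth≤ d v

∈-formulasOfDepth≤ : ∀ {v} d (φ : σFormula v) → ∣ φ ∣ᶠ ℕ.≤ d → φ ∈ formulasOfDepth≤ d v
∈-formulasOfDepth≤ (suc d) (s ≐ t) (ℕ.s≤s l) =
  ∈-++⁺ˡ (∈-cartesianProductWith⁺ _≐_
    (∈-termsOfDepth≤ d s (fst≤ l)) (∈-termsOfDepth≤ d t (snd≤ {∣ s ∣ᵗ} l)))
∈-formulasOfDepth≤ {v} (suc d) (~ φ) (ℕ.s≤s l) =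
  ∈-++⁺ʳ (cartesianProductWith _≐_ ts ts) (∈-++⁺ˡ (∈-map⁺ ~_ (∈-formulasOfDepth≤ d φ l)))
  where ts = termsOfDepth≤ d v
∈-formulasOfDepth≤ {v} (suc d) (φ ∧ ψ) (ℕ.s≤s l) =
  ∈-++⁺ʳ (cartesianProductWith _≐_ ts ts) (∈-++⁺ʳ (map ~_ φs) (∈-++⁺ˡ
    (∈-cartesianProductWith⁺ _∧_
      (∈-formulasOfDepth≤ d φ (fst≤ l)) (∈-formulasOfDepth≤ d ψ (snd≤ {∣ φ ∣ᶠ} l)))))
  where ts = termsOfDepth≤ d v ; φs = formulasOfDepth≤ d v
∈-formulasOfDepth≤ {v} (suc d) (φ ∨ ψ) (ℕ.s≤s l) =
  ∈-++⁺ʳ (cartesianProductWith _≐_ ts ts) (∈-++⁺ʳ (map ~_ φs)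
    (∈-++⁺ʳ (cartesianProductWith _∧_ φs φs) (∈-++⁺ˡ
      (∈-cartesianProductWith⁺ _∨_
        (∈-formulasOfDepth≤ d φ (fst≤ l)) (∈-formulasOfDepth≤ d ψ (snd≤ {∣ φ ∣ᶠ} l))))))
  where ts = termsOfDepth≤ d v ; φs = formulasOfDepth≤ d v
∈-formulasOfDepth≤ {v} (suc d) (φ ⇒ ψ) (ℕ.s≤s l) =
  ∈-++⁺ʳ (cartesianProductWith _≐_ ts ts) (∈-++⁺ʳ (map ~_ φs)
    (∈-++⁺ʳ (cartesianProductWith _∧_ φs φs) (∈-++⁺ʳ (cartesianProductWith _∨_ φs φs)
      (∈-++⁺ˡ (∈-cartesianProductWith⁺ _⇒_
        (∈-formulasOfDepth≤ d φ (fst≤ l)) (∈-formulasOfDepth≤ d ψ (snd≤ {∣ φ ∣ᶠ} l)))))))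
  where ts = termsOfDepth≤ d v ; φs = formulasOfDepth≤ d v
∈-formulasOfDepth≤ {v} (suc d) (∀′ φ) (ℕ.s≤s l) =
  ∈-++⁺ʳ (cartesianProductWith _≐_ ts ts) (∈-++⁺ʳ (map ~_ φs)
    (∈-++⁺ʳ (cartesianProductWith _∧_ φs φs) (∈-++⁺ʳ (cartesianProductWith _∨_ φs φs)
      (∈-++⁺ʳ (cartesianProductWith _⇒_ φs φs) (∈-++⁺ˡ
        (∈-map⁺ ∀′ (∈-formulasOfDepth≤ d φ (ℕₚ.<⇒≤ l))))))))
  where ts = termsOfDepth≤ d v ; φs = formulasOfDepth≤ d v
∈-formulasOfDepth≤ {v} (suc d) (∃′ φ) (ℕ.s≤s l) =
  ∈-++⁺ʳ (cartesianProductWith _≐_ ts ts) (∈-++⁺ʳ (map ~_ φs)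
    (∈-++⁺ʳ (cartesianProductWith _∧_ φs φs) (∈-++⁺ʳ (cartesianProductWith _∨_ φs φs)
      (∈-++⁺ʳ (cartesianProductWith _⇒_ φs φs) (∈-++⁺ʳ (map ∀′ ψs)
        (∈-map⁺ ∃′ (∈-formulasOfDepth≤ d φ (ℕₚ.<⇒≤ l))))))))
  where
  ts = termsOfDepth≤ d v
  φs = formulasOfDepth≤ d v
  ψs = formulasOfDepth≤ d (suc v)

∈-formulasOfLength≤ : ∀ {v} ℓ (φ : σFormula v) → ∣ φ ∣ᶠ ℕ.≤ ℓ → φ ∈ formulasOfLength≤ ℓ v
∈-formulasOfLength≤ ℓ φ l = ∈-filter⁺ (λ χ → ∣ χ ∣ᶠ ℕₚ.≤? ℓ) (∈-formulasOfDepth≤ ℓ φ l) l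

-- The real numbers, axiomatised up to isomorphism as a Dedekind-complete
-- ordered field.
record CompleteOrderedField : Set₁ where
  infix 4 _≤_ _<_
  field
    baseField : Field
  open Field baseField public
  field
    _≤_          : Rel Carrier 0ℓ
    isTotalOrder : IsTotalOrder _≈_ _≤_
    +-monoˡ-≤    : ∀ {x y} z → x ≤ y → x + z ≤ y + z
    *-nonneg     : ∀ {x y} → 0# ≤ x → 0# ≤ y → 0# ≤ x * y

  UpperBound : Pred Carrier 0ℓ → Pred Carrier 0ℓ
  UpperBound S u = ∀ x → S x → x ≤ u

  field
    -- constrained only on nonempty sets that are bounded above
    sup       : Pred Carrier 0ℓ → Carrier
    sup-upper : ∀ S → ∃ S → ∃ (UpperBound S) → UpperBound S (sup S)
    sup-least : ∀ S → ∃ S → ∀ u → UpperBound S u → sup S ≤ u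

  totalOrder : TotalOrder 0ℓ 0ℓ 0ℓ
  totalOrder = record { isTotalOrder = isTotalOrder }

  open Max totalOrder public using (_⊔_)
  open Extrema totalOrder public using (max)

  _<_ : Rel Carrier 0ℓ
  x < y = x ≤ y × ¬ x ≈ y

  ⌜_⌝ : ℕ → Carrier
  ⌜ n ⌝ = n · 1#

  ∣_∣ : Carrier → Carrier
  ∣ x ∣ = x ⊔ - x

  √_ : Carrier → Carrier
  √ x = sup λ r → r * r ≤ x

  -- log_p x = sup { (a - c) / (1 + b) : p ^ ((a - c) / (1 + b)) ≤ x }, with
  -- a, b, c natural numbers; used for p ≥ 2 and x > 0.
  log : ℕ → Carrier → Carrier
  log p x = sup λ r → Σ ℕ λ a → Σ ℕ λ b → Σ ℕ λ c →
    (⌜ suc b ⌝ * r + ⌜ c ⌝ ≈ ⌜ a ⌝) × (⌜ p ⌝ ^ a ≤ ⌜ p ⌝ ^ c * x ^ suc b)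

-- A choice of C_ψ and D_ψ for every ring formula ψ(x, y) with |x| = n and
-- |y| = m.  A pair (d , μ) of naturals and reals stands for the main term
-- μ q^d.
record CountingData (ℝ : CompleteOrderedField) : Set₁ where
  private module ℝ = CompleteOrderedField ℝ
  open ℝ using (⌜_⌝; ∣_∣; √_)
  field
    C : ∀ n m → RingFormula (n ℕ.+ m) → ℝ.Carrier
    D : ∀ n m → RingFormula (n ℕ.+ m) → List (Fin (suc n) × ℝ.Carrier)

    C-positive : ∀ n m ψ → ℝ.0# ℝ.< C n m ψ
    D-positive : ∀ n m ψ → All (λ (d , μ) → ℝ.0# ℝ.< μ) (D n m ψ)

    -- √ ⌜ q ⌝ ⁻¹ * ⌜ q ⌝ ^ d is q ^ (d - 1/2).
    estimate : ∀ n m ψ (K : Field) q → HasCard (Field.setoid K) q →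
      (a : Vector (Field.Carrier K) m) →
      let ψ[Kⁿ,a] = RingSemantics.Solutions K n ψ a in
      Setoid.Carrier ψ[Kⁿ,a] →
      ∀ N → HasCard ψ[Kⁿ,a] N →
      ∃ λ ((d , μ) : Fin (suc n) × ℝ.Carrier) → (d , μ) ∈ D n m ψ ×
        ∣ ⌜ N ⌝ ℝ.- μ ℝ.* ⌜ q ⌝ ℝ.^ toℕ d ∣
          ℝ.≤ C n m ψ ℝ.* (⌜ q ⌝ ℝ.^ toℕ d ℝ.* (√ ⌜ q ⌝) ℝ.⁻¹)

  E : ∀ n m → RingFormula (n ℕ.+ m) → List ℝ.Carrier
  E n m ψ = map proj₂ (D n m ψ)

  -- Every μ is positive, so the default value 0# of the maxima below matters
  -- only where the maximum would be taken over the empty set.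
  bound : ℕ → ∀ n m → σFormula (n ℕ.+ m) → ℝ.Carrier
  bound p n m φ = ℝ.max ℝ.0# (concatMap values (E n m φₚ))
    where
    φₚ = φ ⟨σ≔Frob p ⟩
    values : ℝ.Carrier → List ℝ.Carrier
    values μ = μ ∷ μ ℝ.⁻¹ ∷ ⌜ 2 ⌝ ℝ.* ℝ.log p (⌜ 2 ⌝ ℝ.* C n m φₚ ℝ.* μ ℝ.⁻¹) ∷ []

  -- The maximum over all φ(x, y) with |φ| ≤ ℓ and |x| + |y| ≤ ℓ.  Variables
  -- occurring in φ number at most |φ|, so the second condition only limits
  -- dummy variables, without which the maximum would range over infinitely
  -- many formulas.
  f : ℕ → ℕ → ℝ.Carrier
  f ℓ p = ℝ.max ℝ.0#
    (concatMap (λ n → concatMap (λ m → map (bound p n m) (formulasOfLength≤ ℓ (n ℕ.+ m)))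
                                (upTo (suc (ℓ ℕ.∸ n))))
               (upTo (suc ℓ)))

record IsFilter {I : Set} (𝓕 : Pred (Pred I 0ℓ) 0ℓ) : Set₁ where
  field
    full   : 𝓕 Pred.U
    meet   : ∀ {A B} → 𝓕 A → 𝓕 B → 𝓕 (A ∩ B)
    upward : ∀ {A B} → A ⊆ B → 𝓕 A → 𝓕 B
    proper : ¬ 𝓕 Pred.∅

record IsUltrafilter {I : Set} (𝓤 : Pred (Pred I 0ℓ) 0ℓ) : Set₁ where
  field
    isFilter : IsFilter 𝓤
    ultra    : ∀ A → 𝓤 A ⊎ 𝓤 (∁ A)
  open IsFilter isFilter public

Principal : {I : Set} → Pred (Pred I 0ℓ) 0ℓ → Set₁
Principal {I} 𝓤 = Σ I λ i → ∀ A → 𝓤 A ⇔ A i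

UltrafilterLemma : Set₁
UltrafilterLemma = ∀ {I : Set} (𝓕 : Pred (Pred I 0ℓ) 0ℓ) → IsFilter 𝓕 →
  Σ (Pred (Pred I 0ℓ) 0ℓ) λ 𝓤 → IsUltrafilter 𝓤 × 𝓕 ⊆ 𝓤

module Ultraproduct {I : Set} {𝓤 : Pred (Pred I 0ℓ) 0ℓ} (isUltrafilter : IsUltrafilter 𝓤)
  (K : I → Field) where
  open IsUltrafilter isUltrafilter
  private module K i = Field (K i)

  Carrier : Set
  Carrier = ∀ i → K.Carrier i

  infix 4 _≈_
  _≈_ : Rel Carrier 0ℓ
  x ≈ y = 𝓤 λ i → K._≈_ i (x i) (y i)

  private
    always : {A : Pred I 0ℓ} → (∀ i → A i) → 𝓤 A
    always h = upward (λ {i} _ → h i) full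

    lift₂ : {A B C : Pred I 0ℓ} → (∀ i → A i → B i → C i) → 𝓤 A → 𝓤 B → 𝓤 C
    lift₂ h a b = upward (λ {i} (u , v) → h i u v) (meet a b)

  ring : CommutativeRing 0ℓ 0ℓ
  ring = record
    { Carrier = Carrier
    ; _≈_ = _≈_
    ; _+_ = λ x y i → K._+_ i (x i) (y i)
    ; _*_ = λ x y i → K._*_ i (x i) (y i)
    ; -_  = λ x i → K.-_ i (x i)
    ; 0#  = K.0#
    ; 1#  = K.1#
    ; isCommutativeRing = record
      { isRing = record
        { +-isAbelianGroup = record
          { isGroup = record
            { isMonoid = record
              { isSemigroup = record
                { isMagma = record
                  { isEquivalence = record
                    { refl  = always λ i → K.refl i
                    ; sym   = upward λ {i} → K.sym i
                    ; trans = lift₂ λ i → K.trans i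
                    }
                  ; ∙-cong = lift₂ λ i → K.+-cong i
                  }
                ; assoc = λ x y z → always λ i → K.+-assoc i (x i) (y i) (z i)
                }
              ; identity = (λ x → always λ i → K.+-identityˡ i (x i))
                         , (λ x → always λ i → K.+-identityʳ i (x i))
              }
            ; inverse = (λ x → always λ i → K.-‿inverseˡ i (x i))
                      , (λ x → always λ i → K.-‿inverseʳ i (x i))
            ; ⁻¹-cong = upward λ {i} → K.-‿cong i
            }
          ; comm = λ x y → always λ i → K.+-comm i (x i) (y i)
          }
        ; *-cong = lift₂ λ i → K.*-cong i
        ; *-assoc = λ x y z → always λ i → K.*-assoc i (x i) (y i) (z i)
        ; *-identity = (λ x → always λ i → K.*-identityˡ i (x i))
                     , (λ x → always λ i → K.*-identityʳ i (x i))
        ; distrib = (λ x y z → always λ i → K.distribˡ i (x i) (y i) (z i))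
                  , (λ x y z → always λ i → K.distribʳ i (x i) (y i) (z i))
        }
      ; *-comm = λ x y → always λ i → K.*-comm i (x i) (y i)
      }
    }

  ultraproduct : Field
  ultraproduct = record
    { commutativeRing = ring
    ; _⁻¹       = λ x i → K._⁻¹ i (x i)
    ; *-inverse = inverse
    ; 0≉1       = λ e → proper (upward (λ {i} → K.0≉1 i) e)
    }
    where
    inverse : ∀ x → ¬ x ≈ K.0# → 𝓤 λ i → K._≈_ i (K._*_ i (x i) (K._⁻¹ i (x i))) (K.1# i)
    inverse x x≉0 with ultra (λ i → K._≈_ i (x i) (K.0# i))
    ... | inj₁ x≈0 = contradiction x≈0 x≉0
    ... | inj₂ nz  = upward (λ {i} → K.*-inverse i (x i)) nz

-- 𝔽 p is the field with p ^ k p elements; quantifying over all fields of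
-- that cardinality makes 𝒮 independent of a choice among isomorphic ones.
record 𝒮 {ℝ : CompleteOrderedField} (𝒟 : CountingData ℝ) : Set₁ where
  private module ℝ = CompleteOrderedField ℝ
  open CountingData 𝒟 using (f)
  field
    𝓤             : Pred (Pred ℙ 0ℓ) 0ℓ
    isUltrafilter : IsUltrafilter 𝓤
    nonPrincipal  : ¬ Principal 𝓤
    k             : ℙ → ℕ
    large         : ∀ p → f (value p) (value p) ℝ.≤ ℝ.⌜ k p ⌝
    𝔽             : ℙ → Field
    cardinality   : ∀ p → HasCard (Field.setoid (𝔽 p)) (value p ℕ.^ k p)

  structure : σField
  structure = record
    { baseField = Ultraproduct.ultraproduct isUltrafilter 𝔽
    ; σ         = λ x p → Field._^_ (𝔽 p) (x p) (value p)
    ; σ-cong    = IsUltrafilter.upward isUltrafilter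
                    λ {p} → Exp.^-congˡ (Field.semiring (𝔽 p)) (value p)
    }

-- Poly A n is A[X₁, …, Xₙ], a polynomial being the list of its coefficients
-- (in A[X₂, …, Xₙ]) by increasing degree in X₁.
Poly : Set → ℕ → Set
Poly A zero    = A
Poly A (suc n) = List (Poly A n)

AllCoefficients : {A : Set} → Pred A 0ℓ → ∀ n → Pred (Poly A n) 0ℓ
AllCoefficients P zero    c  = P c
AllCoefficients P (suc n) cs = All (AllCoefficients P n) cs

module DifferenceAlgebra (M : σField) where
  open σField M hiding (zero)

  evaluate : ∀ n → Poly Carrier n → Vector Carrier n → Carrier
  evaluate zero    c  x = c
  evaluate (suc n) cs x =
    foldr (λ c s → evaluate n c (Vector.tail x) + Vector.head x * s) 0# cs

  -- The smallest subfield containing S and closed under R-successors.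
  data Generated (R : Rel Carrier 0ℓ) (S : Pred Carrier 0ℓ) : Pred Carrier 0ℓ where
    gen  : ∀ {x} → S x → Generated R S x
    resp : ∀ {x y} → x ≈ y → Generated R S x → Generated R S y
    0∈   : Generated R S 0#
    1∈   : Generated R S 1#
    +∈   : ∀ {x y} → Generated R S x → Generated R S y → Generated R S (x + y)
    -∈   : ∀ {x} → Generated R S x → Generated R S (- x)
    *∈   : ∀ {x y} → Generated R S x → Generated R S y → Generated R S (x * y)
    ⁻¹∈  : ∀ {x} → ¬ x ≈ 0# → Generated R S x → Generated R S (x ⁻¹)
    step : ∀ {x y} → R x y → Generated R S x → Generated R S y

  subfield : Pred Carrier 0ℓ → Pred Carrier 0ℓ
  subfield = Generated λ _ _ → ⊥

  differenceSubfield : Pred Carrier 0ℓ → Pred Carrier 0ℓ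
  differenceSubfield = Generated λ x y → (y ≈ σ x) ⊎ (x ≈ σ y)

  entries : ∀ {m} → Vector Carrier m → Pred Carrier 0ℓ
  entries b x = ∃ λ i → x ≈ b i

  AlgebraicOver : Pred Carrier 0ℓ → Pred Carrier 0ℓ
  AlgebraicOver E x = Σ (Poly Carrier 1) λ P →
    AllCoefficients E 1 P × ¬ AllCoefficients (_≈ 0#) 1 P × evaluate 1 P (λ _ → x) ≈ 0#

  AlgebraicallyIndependent : Pred Carrier 0ℓ → ∀ {n} → Vector Carrier n → Set
  AlgebraicallyIndependent E {n} t = (P : Poly Carrier n) →
    AllCoefficients E n P → evaluate n P t ≈ 0# → AllCoefficients (_≈ 0#) n P

  -- For subfields E ⊆ L: t is a transcendence basis of L over E.
  TrDeg : Pred Carrier 0ℓ → Pred Carrier 0ℓ → ℕ → Set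
  TrDeg L E n = Σ (Vector Carrier n) λ t →
    (∀ i → L (t i)) × AlgebraicallyIndependent E t ×
    (∀ x → L x → AlgebraicOver (subfield (E ∪ entries t)) x)

  degσ[_/ᴱ_]≡_ : ∀ {l} → Vector Carrier l → Pred Carrier 0ℓ → ℕ → Set
  degσ[ a /ᴱ E ]≡ n = TrDeg (differenceSubfield (E ∪ entries a)) E n

  degσ[_/_]≡_ : ∀ {l m} → Vector Carrier l → Vector Carrier m → ℕ → Set
  degσ[ a / b ]≡ n = degσ[ a /ᴱ differenceSubfield (entries b) ]≡ n

{-# OPTIONS --safe #-}
module Submission where

-- Let a be generic over b and put c = σⁿ(a) − b a.  If b is not of the form
-- σⁿ(y) / y with y ≠ 0, then a is the only solution of σⁿ(x) = b x + c, hence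
-- definable over (b , c).  Such b exist since in a finite field of odd
-- characteristic the map y ↦ σⁿ(y) / y identifies 1 and −1, so is not onto.
-- Genericity is arranged in each 𝔽ₚ: the value at (x , x^p , x^p² , …) of a
-- polynomial of degree < p in every variable is, by Kronecker substitution, a
-- nonzero polynomial in x unless the given one is zero, and a large field has
-- a point that avoids the roots of a prescribed finite set of them.  So any
-- difference polynomial over b vanishing at a vanishes on all sequences A in
-- place of (σⁱ a)ᵢ.  A relation between a , σ a , … , σⁿ⁻¹ a over the difference
-- field of (b , c) becomes, after clearing denominators and applying a power
-- of σ, such a polynomial; it vanishes on all sequences that solve
-- A_{n+j} = σʲ(b) A_j + σʲ(c), any n consecutive entries of which are arbitrary.
-- Hence the relation is trivial and degσ = n.

open import Defs
open import Algebra.Bundles using (CommutativeRing; AbelianGroup)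
import Algebra.Construct.DirectProduct as DirectProduct
import Algebra.Properties.CommutativeSemiring.Binomial as Binomial
import Algebra.Properties.CommutativeSemiring.Exp as CommutativeExp
import Algebra.Properties.Monoid.Sum as MonoidSum
import Algebra.Properties.Semiring.Mult as SemiringMult
import Algebra.Solver.Ring.NaturalCoefficients.Default as SemiringSolver
open import Axiom.ExcludedMiddle using (ExcludedMiddle)
open import Data.Empty using (⊥)
open import Data.Fin.Base as Fin using (Fin; toℕ; zero; suc)
import Data.Fin.Properties as Finₚ
open import Data.Integer.Base as ℤ using (ℤ; +_)
import Data.Integer.DivMod as ℤDivMod
import Data.Integer.Divisibility.Signed as ℤ∣
import Data.Integer.Properties as ℤₚ
open import Data.Integer.Tactic.RingSolver using (solve-∀)
open import Data.Irrelevant using ([_])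
open import Data.List.Base as List using (List; length; filter; foldr; tabulate)
open import Data.List.Membership.Propositional using (_∈_)
open import Data.List.Membership.Propositional.Properties using (∈-filter⁻)
import Data.List.Properties as Listₚ
open import Data.List.Relation.Unary.All as All using (All)
import Data.List.Relation.Unary.All.Properties as Allₚ
open import Data.List.Relation.Unary.AllPairs as AllPairs using (AllPairs)
import Data.List.Relation.Unary.AllPairs.Properties as AllPairsₚ
open import Data.List.Relation.Unary.Any using (here; there)
open import Data.Nat.Base as ℕ using (ℕ; zero; suc; _>_; z≤n; s≤s; _!)
open import Data.Nat.Combinatorics using (_C_; nCk≡n!/k![n-k]!; nCn≡1; k![n∸k]!∣n!)
open import Data.Nat.Coprimality using (prime⇒coprime; coprime-Bézout)
open import Data.Nat.Divisibility as ℕ∣ using (_∣_)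
open import Data.Nat.DivMod using (_/_; _%_; m<n⇒m/n≡0; m<n⇒m%n≡m; m%n<n; m≡m%n+[m/n]*n; m/n*n≡m; m/n≡1+[m∸n]/n; m*n/n≡m; [m+n]%n≡m%n; [m+kn]%n≡m%n; +-distrib-/-∣ʳ)
open import Data.Nat.GCD using (module Bézout)
open import Data.Nat.ListAction using (product)
open import Data.Nat.Primality using (Prime; prime?; prime⇒nonZero; prime⇒nonTrivial; prime⇒irreducible; euclidsLemma)
open import Data.Nat.Primality.Factorisation using (factorise; module PrimeFactorisation)
import Data.Nat.Properties as ℕₚ
open import Data.Product.Base using (Σ; ∃; _×_; _,_; proj₁; proj₂)
open import Data.Refinement using (value; _,_)
open import Data.Sum.Base using (inj₁; inj₂; [_,_]′)
open import Data.Vec.Functional as Vector using (Vector)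
open import Function.Base using (_∘_; case_of_; flip; id)
open import Function.Bundles using (Inverse; Equivalence)
open import Level using (0ℓ)
open import Relation.Binary.Bundles using (Setoid)
open import Relation.Binary.PropositionalEquality as ≡ using (_≡_)
open import Relation.Binary.Structures using (IsTotalOrder)
open import Relation.Nullary.Decidable using (Dec; yes; no; ¬?; decidable-stable; recompute)
open import Relation.Nullary.Negation using (¬_; contradiction)
open import Relation.Unary using (Decidable; Pred; _∪_)

-- Uniqueness of `a` and its large degree are compatible because uniqueness comes from finiteness
-- and not from equations. At `p` the equation σⁿ(y) = b y reads y ^ (p ^ n) = b y; for b ≠ 0 it has
-- p ^ n solutions in an algebraic closure, and only counting values in a finite field rules out the
-- nonzero ones. The delicate point is the field over which the degree is taken. As c is built from
-- `a`, numerators and denominators of elements of the difference field of (b , c) are terms in `a`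
-- too, so genericity over b cannot be applied to them directly. What helps is that c, read off from
-- a sequence A, is the same for all solutions of the recurrence: a denominator that is nonzero at
-- the orbit of `a` stays nonzero along every solution, although it may vanish on other sequences.
-- The counting data enter only as a lower bound on k_p. This leaves room for fields as large as
-- genericity demands, and for the convenient orders p ^ (2 ^ m).

-- Fields and the roots of univariate polynomials

module FieldProperties (K : Field) where
  open Field K hiding (zero)
  open import Algebra.Properties.Ring ring using (x∙y⁻¹≈ε⇒x≈y; x≈y⇒x∙y⁻¹≈ε; [y-z]x≈yx-zx)
  open import Relation.Binary.Reasoning.Setoid setoid

  x*y≈0⇒y≈0 : ∀ {x y} → ¬ x ≈ 0# → x * y ≈ 0# → y ≈ 0#
  x*y≈0⇒y≈0 {x} {y} x≉0 xy≈0 = begin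
    y                 ≈⟨ *-identityˡ y ⟨
    1# * y            ≈⟨ *-congʳ (*-inverse x x≉0) ⟨
    x * x ⁻¹ * y      ≈⟨ *-congʳ (*-comm x (x ⁻¹)) ⟩
    x ⁻¹ * x * y      ≈⟨ *-assoc (x ⁻¹) x y ⟩
    x ⁻¹ * (x * y)    ≈⟨ *-congˡ xy≈0 ⟩
    x ⁻¹ * 0#         ≈⟨ zeroʳ (x ⁻¹) ⟩
    0#                ∎

  *-≉0 : ∀ {x y} → ¬ x ≈ 0# → ¬ y ≈ 0# → ¬ x * y ≈ 0#
  *-≉0 x≉0 y≉0 = y≉0 ∘ x*y≈0⇒y≈0 x≉0

  xz≈yz⇒z≈0 : ∀ {x y z} → ¬ x ≈ y → x * z ≈ y * z → z ≈ 0#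
  xz≈yz⇒z≈0 {x} {y} {z} x≉y xz≈yz = x*y≈0⇒y≈0 (x≉y ∘ x∙y⁻¹≈ε⇒x≈y x y)
    (trans ([y-z]x≈yx-zx z x y) (x≈y⇒x∙y⁻¹≈ε xz≈yz))

  *-cancelʳ : ∀ {x y z} → ¬ z ≈ 0# → x * z ≈ y * z → x ≈ y
  *-cancelʳ {x} {y} {z} z≉0 xz≈yz = x∙y⁻¹≈ε⇒x≈y x y (x*y≈0⇒y≈0 z≉0
    (trans (*-comm z (x - y)) (trans ([y-z]x≈yx-zx z x y) (x≈y⇒x∙y⁻¹≈ε xz≈yz))))

module UnivariatePolynomials (K : Field) where
  open List.List using ([]; _∷_)
  open All.All using ([]; _∷_)
  open AllPairs.AllPairs using ([]; _∷_)
  open Field K hiding (zero)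
  open FieldProperties K
  open import Relation.Binary.Reasoning.Setoid setoid
  open SemiringSolver commutativeSemiring using (solve; _:=_; _:+_; _:*_; con)

  Distinct : List Carrier → Set
  Distinct = AllPairs λ x y → ¬ x ≈ y

  -- Coefficients form a total function on ℕ of which only the first `L` count, so that a Kronecker
  -- substitution is a mere reindexing.
  horner : ℕ → (ℕ → Carrier) → Carrier → Carrier
  horner zero    c x = 0#
  horner (suc L) c x = c 0 + x * horner L (c ∘ suc) x

  horner-cong : ∀ L {c d} → (∀ i → i ℕ.< L → c i ≈ d i) → ∀ x → horner L c x ≈ horner L d x
  horner-cong zero    c≈d x = refl
  horner-cong (suc L) c≈d x =
    +-cong (c≈d 0 (s≤s z≤n)) (*-congˡ (horner-cong L (λ i → c≈d (suc i) ∘ s≤s) x))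

  horner-0 : ∀ L {c} → (∀ i → i ℕ.< L → c i ≈ 0#) → ∀ x → horner L c x ≈ 0#
  horner-0 zero    c≈0 x = refl
  horner-0 (suc L) c≈0 x = begin
    _            ≈⟨ +-cong (c≈0 0 (s≤s z≤n)) (*-congˡ (horner-0 L (λ i → c≈0 (suc i) ∘ s≤s) x)) ⟩
    0# + x * 0#  ≈⟨ trans (+-identityˡ _) (zeroʳ x) ⟩
    0#           ∎

  horner-+ : ∀ L c d x → horner L c x + horner L d x ≈ horner L (λ i → c i + d i) x
  horner-+ zero    c d x = +-identityˡ 0#
  horner-+ (suc L) c d x = begin
    c 0 + x * h + (d 0 + x * k)
      ≈⟨ solve 5 (λ c d h k x → c :+ x :* h :+ (d :+ x :* k) := c :+ d :+ x :* (h :+ k)) refl (c 0) (d 0) h k x ⟩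
    c 0 + d 0 + x * (h + k)        ≈⟨ +-congˡ (*-congˡ (horner-+ L _ _ x)) ⟩
    _                              ∎
    where h = horner L (c ∘ suc) x ; k = horner L (d ∘ suc) x

  horner-* : ∀ L a c x → a * horner L c x ≈ horner L (λ i → a * c i) x
  horner-* zero    a c x = zeroʳ a
  horner-* (suc L) a c x = begin
    a * (c 0 + x * h)        ≈⟨ solve 4 (λ a c h x → a :* (c :+ x :* h) := a :* c :+ x :* (a :* h)) refl a (c 0) h x ⟩
    a * c 0 + x * (a * h)    ≈⟨ +-congˡ (*-congˡ (horner-* L a _ x)) ⟩
    _                        ∎
    where h = horner L (c ∘ suc) x

  horner-++ : ∀ m n c x → horner (m ℕ.+ n) c x ≈ horner m c x + x ^ m * horner n (λ i → c (m ℕ.+ i)) x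
  horner-++ zero    n c x = sym (trans (+-identityˡ _) (*-identityˡ _))
  horner-++ (suc m) n c x = begin
    c 0 + x * horner (m ℕ.+ n) (c ∘ suc) x  ≈⟨ +-congˡ (*-congˡ (horner-++ m n (c ∘ suc) x)) ⟩
    c 0 + x * (h + x ^ m * k)
      ≈⟨ solve 5 (λ c h k x y → c :+ x :* (h :+ y :* k) := c :+ x :* h :+ x :* y :* k) refl (c 0) h k x (x ^ m) ⟩
    c 0 + x * h + x * x ^ m * k             ∎
    where h = horner m (c ∘ suc) x ; k = horner n (λ i → c (suc m ℕ.+ i)) x

  private
    -- Division by X − x; the defining identity c(y) = (y − x) q(y) + c(x) is
    -- stated without subtraction.
    divide : ∀ L c x → Σ (ℕ → Carrier) λ q →
      (∀ y → horner (suc L) c y + x * horner L q y ≈ y * horner L q y + horner (suc L) c x) ×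
      ((∀ i → i ℕ.< L → q i ≈ 0#) → horner (suc L) c x ≈ 0# → ∀ i → i ℕ.< suc L → c i ≈ 0#)
    divide zero c x = c ,
      (λ y → solve 3 (λ c x y → c :+ y :* con 0 :+ x :* con 0 := y :* con 0 :+ (c :+ x :* con 0)) refl (c 0) x y)
      , λ { _ e zero _ → trans (sym (trans (+-congˡ (zeroʳ x)) (+-identityʳ _))) e ; _ _ (suc i) (s≤s ()) }
    divide (suc L) c x with divide L (c ∘ suc) x
    ... | q′ , identity , vanish = q , identity′ , vanish′
      where
      cₓ = horner (suc L) (c ∘ suc) x
      q : ℕ → Carrier
      q zero    = cₓ
      q (suc i) = q′ i
      identity′ : ∀ y → horner (suc (suc L)) c y + x * horner (suc L) q y
                      ≈ y * horner (suc L) q y + horner (suc (suc L)) c x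
      identity′ y = begin
        c 0 + y * h + x * (cₓ + y * g)
          ≈⟨ solve 6 (λ c y h x cₓ g →
               c :+ y :* h :+ x :* (cₓ :+ y :* g) := c :+ y :* (h :+ x :* g) :+ x :* cₓ) refl (c 0) y h x cₓ g ⟩
        c 0 + y * (h + x * g) + x * cₓ     ≈⟨ +-congʳ (+-congˡ (*-congˡ (identity y))) ⟩
        c 0 + y * (y * g + cₓ) + x * cₓ
          ≈⟨ solve 5 (λ c y x cₓ g →
               c :+ y :* (y :* g :+ cₓ) :+ x :* cₓ := y :* (cₓ :+ y :* g) :+ (c :+ x :* cₓ)) refl (c 0) y x cₓ g ⟩
        y * (cₓ + y * g) + (c 0 + x * cₓ)  ∎
        where h = horner (suc L) (c ∘ suc) y ; g = horner L q′ y
      vanish′ : (∀ i → i ℕ.< suc L → q i ≈ 0#) → horner (suc (suc L)) c x ≈ 0# → ∀ i → i ℕ.< suc (suc L) → c i ≈ 0#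
      vanish′ q≈0 e zero _ = begin
        c 0            ≈⟨ trans (+-congˡ (zeroʳ x)) (+-identityʳ _) ⟨
        c 0 + x * 0#   ≈⟨ +-congˡ (*-congˡ (q≈0 0 (s≤s z≤n))) ⟨
        c 0 + x * cₓ   ≈⟨ e ⟩
        0#             ∎
      vanish′ q≈0 e (suc i) (s≤s i<L) = vanish (λ i → q≈0 (suc i) ∘ s≤s) (q≈0 0 (s≤s z≤n)) i i<L

  -- Each root splits off a linear factor, and the other points stay roots of the quotient because
  -- they differ from the root removed and a field has no zero divisors.
  coefficients≈0 : ∀ L c {xs} → Distinct xs → L ℕ.≤ length xs →
    All (λ x → horner L c x ≈ 0#) xs → ∀ i → i ℕ.< L → c i ≈ 0#
  coefficients≈0 (suc L) c {x ∷ xs} (x≉xs ∷ distinct) (s≤s L≤) (cx≈0 ∷ cxs≈0) with divide L c x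
  ... | q , identity , vanish = vanish (coefficients≈0 L q distinct L≤ (All.zipWith root (x≉xs , cxs≈0))) cx≈0
    where
    root : ∀ {y} → ¬ x ≈ y × horner (suc L) c y ≈ 0# → horner L q y ≈ 0#
    root {y} (x≉y , cy≈0) = xz≈yz⇒z≈0 x≉y (begin
      x * horner L q y                          ≈⟨ +-identityˡ _ ⟨
      0# + x * horner L q y                     ≈⟨ +-congʳ cy≈0 ⟨
      horner (suc L) c y + x * horner L q y     ≈⟨ identity y ⟩
      y * horner L q y + horner (suc L) c x     ≈⟨ +-congˡ cx≈0 ⟩
      y * horner L q y + 0#                     ≈⟨ +-identityʳ _ ⟩
      y * horner L q y                          ∎)

  -- Substituting x ^ p for the variable of the coefficient polynomials of a
  -- polynomial of degree < p produces no overlap between the terms.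
  horner-interleave : ∀ p .{{_ : ℕ.NonZero p}} N (c : ℕ → ℕ → Carrier) x →
    horner p (λ i → horner N (c i) (x ^ p)) x ≈ horner (N ℕ.* p) (λ m → c (m % p) (m / p)) x
  horner-interleave p zero    c x = horner-0 p (λ _ _ → refl) x
  horner-interleave p (suc N) c x = begin
    horner p (λ i → c i 0 + x ^ p * horner N (c i ∘ suc) (x ^ p)) x
      ≈⟨ horner-+ p _ _ x ⟨
    horner p (λ i → c i 0) x + horner p (λ i → x ^ p * horner N (c i ∘ suc) (x ^ p)) x
      ≈⟨ +-congˡ (horner-* p _ _ x) ⟨
    horner p (λ i → c i 0) x + x ^ p * horner p (λ i → horner N (c i ∘ suc) (x ^ p)) x
      ≈⟨ +-cong (horner-cong p low x) (*-congˡ (trans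
           (horner-interleave p N (λ i → c i ∘ suc) x)
           (horner-cong (N ℕ.* p) (λ i _ → reflexive (high i)) x))) ⟩
    horner p d x + x ^ p * horner (N ℕ.* p) (λ m → d (p ℕ.+ m)) x
      ≈⟨ horner-++ p (N ℕ.* p) d x ⟨
    horner (suc N ℕ.* p) d x ∎
    where
    d : ℕ → Carrier
    d m = c (m % p) (m / p)
    low : ∀ i → i ℕ.< p → c i 0 ≈ d i
    low i i<p = reflexive (≡.sym (≡.cong₂ c (m<n⇒m%n≡m i<p) (m<n⇒m/n≡0 i<p)))
    high : ∀ m → c (m % p) (suc (m / p)) ≡ d (p ℕ.+ m)
    high m = ≡.sym (≡.cong₂ c
      (≡.trans (≡.cong (_% p) (ℕₚ.+-comm p m)) ([m+n]%n≡m%n m p))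
      (≡.trans (m/n≡1+[m∸n]/n (ℕₚ.m≤m+n p m)) (≡.cong (suc ∘ (_/ p)) (ℕₚ.m+n∸m≡n p m))))

module FilterProperties where
  open List.List using ([]; _∷_)

  length-filter-¬ : {A : Set} {P : Pred A 0ℓ} (P? : Decidable P) (xs : List A) →
    length (filter P? xs) ℕ.+ length (filter (¬? ∘ P?) xs) ≡ length xs
  length-filter-¬ P? []       = ≡.refl
  length-filter-¬ P? (x ∷ xs) with P? x
  ... | yes _ = ≡.cong suc (length-filter-¬ P? xs)
  ... | no  _ = ≡.trans (ℕₚ.+-suc _ _) (≡.cong suc (length-filter-¬ P? xs))

-- Difference terms as polynomial functions of sequences

-- Applying `f` on the inside makes the shifted orbit of `x` definitionally the orbit of `f x`.
orbit : {A : Set} → (A → A) → A → ℕ → A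
orbit f x zero    = x
orbit f x (suc i) = orbit f (f x) i

-- Difference terms over the ring of sequences, σ being the left shift: a
-- sequence A plays the role of (a, σ a, σ² a, …) with its entries made
-- independent of each other.
module SequenceSemantics (K : Field) where
  open Field K hiding (zero)

  Sequence : Set
  Sequence = ℕ → Carrier

  ⟦_⟧ˢ : ∀ {v} → σTerm v → (Fin v → Sequence) → Sequence
  ⟦ var i  ⟧ˢ ρ j = ρ i j
  ⟦ 𝟎      ⟧ˢ ρ j = 0#
  ⟦ 𝟏      ⟧ˢ ρ j = 1#
  ⟦ ⊖ t    ⟧ˢ ρ j = - ⟦ t ⟧ˢ ρ j
  ⟦ σ⟨ t ⟩ ⟧ˢ ρ j = ⟦ t ⟧ˢ ρ (suc j)
  ⟦ s ⊕ t  ⟧ˢ ρ j = ⟦ s ⟧ˢ ρ j + ⟦ t ⟧ˢ ρ j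
  ⟦ s ⊗ t  ⟧ˢ ρ j = ⟦ s ⟧ˢ ρ j * ⟦ t ⟧ˢ ρ j

  ⟨_,_⟩ : Sequence → Sequence → Fin 2 → Sequence
  ⟨ A , B ⟩ = A Vector.∷ B Vector.∷ Vector.[]

module PolynomialFunctions (K : Field) where
  open Field K hiding (zero)
  open import Algebra.Properties.Ring ring using (-1*x≈-x)
  open UnivariatePolynomials K
  open SequenceSemantics K
  open import Relation.Binary.Reasoning.Setoid setoid
  open SemiringSolver commutativeSemiring using (solve; _:=_; _:+_; _:*_; con)

  -- The degree bound `L` in the first entry is kept apart from the bound hidden in `Q`, so that
  -- products can be formed by recursion on `L` while the bound for the other entries stays fixed.
  record Layer (Q : Pred (Sequence → Carrier) 0ℓ) (L : ℕ) (G : Sequence → Carrier) : Set where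
    constructor layer
    field
      coefficient : ℕ → Sequence → Carrier
      valid       : ∀ i → Q (coefficient i)
      expansion   : ∀ A → G A ≈ horner L (λ i → coefficient i (A ∘ suc)) (A 0)

  -- Polynomial functions of the first M entries of a sequence, of degree < D
  -- in each of them.
  PolyFun : ℕ → ℕ → Pred (Sequence → Carrier) 0ℓ
  PolyFun zero    D G = Σ Carrier λ c → ∀ A → G A ≈ c
  PolyFun (suc M) D G = Layer (PolyFun M D) D G

  private
    variable
      M D D′ L L′ : ℕ
      Q Q′ : Pred (Sequence → Carrier) 0ℓ
      F G : Sequence → Carrier

  nil : Q (λ _ → 0#) → (∀ A → G A ≈ 0#) → Layer Q L G
  nil {L = L} q0 G≈0 = layer (λ _ _ → 0#) (λ _ → q0) λ A → trans (G≈0 A) (sym (horner-0 L (λ _ _ → refl) (A 0)))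

  cons : Q F → Layer Q L G → Layer Q (suc L) (λ A → F (A ∘ suc) + A 0 * G A)
  cons {F = F} f (layer g q G≈) =
    layer (λ { zero → F ; (suc i) → g i }) (λ { zero → f ; (suc i) → q i }) λ A → +-congˡ (*-congˡ (G≈ A))

  data Uncons (Q : Pred (Sequence → Carrier) 0ℓ) : ℕ → Pred (Sequence → Carrier) 0ℓ where
    []  : (∀ A → G A ≈ 0#) → Uncons Q zero G
    _∷_∶_ : Q F → ∀ {H} → Layer Q L H → (∀ A → G A ≈ F (A ∘ suc) + A 0 * H A) → Uncons Q (suc L) G

  uncons : Layer Q L G → Uncons Q L G
  uncons {L = zero}  (layer g q G≈) = [] G≈
  uncons {L = suc L} (layer g q G≈) = q 0 ∷ layer (g ∘ suc) (q ∘ suc) (λ A → refl) ∶ G≈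

  Layer-resp : (∀ A → G A ≈ F A) → Layer Q L F → Layer Q L G
  Layer-resp G≈F (layer g q F≈) = layer g q λ A → trans (G≈F A) (F≈ A)

  PolyFun-resp : ∀ M → (∀ A → G A ≈ F A) → PolyFun M D F → PolyFun M D G
  PolyFun-resp zero    G≈F (c , F≈c) = c , λ A → trans (G≈F A) (F≈c A)
  PolyFun-resp (suc M) G≈F = Layer-resp G≈F

  PolyFun-0 : ∀ M → PolyFun M D (λ _ → 0#)
  PolyFun-0 zero    = 0# , λ _ → refl
  PolyFun-0 (suc M) = nil (PolyFun-0 M) λ _ → refl

  Layer-weaken : (∀ {G} → Q G → Q′ G) → Q′ (λ _ → 0#) → L ℕ.≤ L′ → Layer Q L G → Layer Q′ L′ G
  Layer-weaken Q⊆Q′ q0 L≤L′ l with uncons l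
  Layer-weaken Q⊆Q′ q0 z≤n        l | [] G≈ = nil q0 G≈
  Layer-weaken Q⊆Q′ q0 (s≤s L≤L′) l | f ∷ l′ ∶ G≈ =
    Layer-resp G≈ (cons (Q⊆Q′ f) (Layer-weaken Q⊆Q′ q0 L≤L′ l′))

  PolyFun-weaken : ∀ M → D ℕ.≤ D′ → ∀ {G} → PolyFun M D G → PolyFun M D′ G
  PolyFun-weaken zero    D≤D′ = λ f → f
  PolyFun-weaken (suc M) D≤D′ = Layer-weaken (PolyFun-weaken M D≤D′) (PolyFun-0 M) D≤D′

  PolyFun-const : ∀ M c → PolyFun M (suc D) (λ _ → c)
  PolyFun-const zero    c = c , λ _ → refl
  PolyFun-const (suc M) c = Layer-resp (λ A → sym (trans (+-congˡ (zeroʳ (A 0))) (+-identityʳ c)))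
    (cons (PolyFun-const M c) (nil (PolyFun-0 M) λ _ → refl))

  PolyFun-coordinate : ∀ {M} i → i ℕ.< M → PolyFun M (suc (suc D)) (λ A → A i)
  PolyFun-coordinate {M = suc M} zero _ =
    Layer-resp (λ A → sym (trans (+-identityˡ _)
      (trans (*-congˡ (trans (+-congˡ (zeroʳ (A 0))) (+-identityʳ 1#))) (*-identityʳ (A 0)))))
    (cons (PolyFun-0 M) (cons (PolyFun-const M 1#) (nil (PolyFun-0 M) λ _ → refl)))
  PolyFun-coordinate {M = suc M} (suc i) (s≤s i<M) =
    Layer-resp (λ A → sym (trans (+-congˡ (zeroʳ (A 0))) (+-identityʳ _)))
    (cons (PolyFun-coordinate i i<M) (nil (PolyFun-0 M) λ _ → refl))

  Layer-+ : (∀ {F G} → Q F → Q G → Q (λ A → F A + G A)) →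
    Layer Q L F → Layer Q L G → Layer Q L (λ A → F A + G A)
  Layer-+ {L = L} _⊞_ (layer f qf F≈) (layer g qg G≈) = layer (λ i A → f i A + g i A) (λ i → qf i ⊞ qg i) λ A →
    trans (+-cong (F≈ A) (G≈ A)) (horner-+ L _ _ _)

  PolyFun-+ : ∀ M → PolyFun M D F → PolyFun M D G → PolyFun M D (λ A → F A + G A)
  PolyFun-+ zero    (c , F≈) (d , G≈) = c + d , λ A → +-cong (F≈ A) (G≈ A)
  PolyFun-+ (suc M) = Layer-+ (PolyFun-+ M)

  PolyFun-scale : ∀ M c → PolyFun M D G → PolyFun M D (λ A → c * G A)
  PolyFun-scale zero    c (d , G≈) = c * d , λ A → *-congˡ (G≈ A)
  PolyFun-scale {D = D} (suc M) c (layer g q G≈) = layer (λ i A → c * g i A) (λ i → PolyFun-scale M c (q i)) λ A →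
    trans (*-congˡ (G≈ A)) (horner-* D _ _ _)

  PolyFun-neg : ∀ M → PolyFun M D G → PolyFun M D (λ A → - G A)
  PolyFun-neg M f = PolyFun-resp M (λ A → sym (-1*x≈-x _)) (PolyFun-scale M (- 1#) f)

  Layer-scale : {R : Pred (Sequence → Carrier) 0ℓ} → (∀ {G} → Q G → R (λ A → F A * G A)) →
    Layer Q L G → Layer R L (λ A → F (A ∘ suc) * G A)
  Layer-scale {F = F} {L = L} F*_ (layer g q G≈) = layer (λ i A → F A * g i A) (λ i → F* q i) λ A →
    trans (*-congˡ (G≈ A)) (horner-* L (F (A ∘ suc)) _ _)

  -- Recursion on the left factor by (h + x k) g = h g + x (k g); the number of entries drops only
  -- in forming h g. Adding the strict bounds overshoots the degree by one but avoids a subtraction.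
  PolyFun-* : ∀ M → PolyFun M D F → PolyFun M D′ G → PolyFun M (D ℕ.+ D′) (λ A → F A * G A)
  Layer-* : ∀ M → Layer (PolyFun M D) L F → Layer (PolyFun M D′) L′ G →
    Layer (PolyFun M (D ℕ.+ D′)) (L ℕ.+ L′) (λ A → F A * G A)

  PolyFun-* zero    (c , F≈) (d , G≈) = c * d , λ A → *-cong (F≈ A) (G≈ A)
  PolyFun-* (suc M) = Layer-* M

  Layer-* M l l′ with uncons l
  ... | [] F≈ = nil (PolyFun-0 M) λ A → trans (*-congʳ (F≈ A)) (zeroˡ _)
  Layer-* {L = suc L} {L′ = L′} M l l′ | h ∷ l″ ∶ F≈ =
    Layer-resp (λ A → trans (*-congʳ (F≈ A)) (rearrange _ _ _ _))
    (Layer-+ (PolyFun-+ M)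
      (Layer-weaken (λ f → f) (PolyFun-0 M) (ℕₚ.m≤n+m L′ (suc L)) (Layer-scale (PolyFun-* M h) l′))
      (cons (PolyFun-0 M) (Layer-* M l″ l′)))
    where
    rearrange : ∀ h x k g → (h + x * k) * g ≈ h * g + (0# + x * (k * g))
    rearrange h x k g = solve 4 (λ h x k g → (h :+ x :* k) :* g := h :* g :+ (con 0 :+ x :* (k :* g))) refl h x k g

  private
    double-mono : ∀ {m n} → m ℕ.≤ n → m ℕ.+ m ℕ.≤ n ℕ.+ n
    double-mono m≤n = ℕₚ.+-mono-≤ m≤n m≤n

    double-+ : ∀ m n → (m ℕ.+ m) ℕ.+ (n ℕ.+ n) ℕ.≤ suc (m ℕ.+ n) ℕ.+ suc (m ℕ.+ n)
    double-+ m n = ℕₚ.≤-trans (ℕₚ.≤-reflexive (+-interchange m m n n)) (double-mono (ℕₚ.n≤1+n (m ℕ.+ n)))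
      where open import Algebra.Properties.CommutativeSemigroup ℕₚ.+-commutativeSemigroup renaming (interchange to +-interchange)

  -- A variable has length 1 and degree below 2, and degree bounds at most add up, so twice the
  -- length bounds the degree. Each σ costs one symbol and moves the position by one, so
  -- `j + ∣ t ∣ᵗ` bounds the entries that occur.
  termFun : ∀ B M j (t : σTerm 2) → j ℕ.+ ∣ t ∣ᵗ ℕ.≤ M →
    PolyFun M (∣ t ∣ᵗ ℕ.+ ∣ t ∣ᵗ) (λ A → ⟦ t ⟧ˢ ⟨ A , B ⟩ j)
  termFun B M j (var zero)       l = PolyFun-coordinate j (ℕₚ.≤-trans (ℕₚ.≤-reflexive (≡.sym (ℕₚ.+-comm j 1))) l)
  termFun B M j (var (suc zero)) l = PolyFun-const M (B j)
  termFun B M j 𝟎 l = PolyFun-0 M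
  termFun B M j 𝟏 l = PolyFun-const M 1#
  termFun B M j (⊖ t) l = PolyFun-weaken M (double-mono (ℕₚ.n≤1+n _))
    (PolyFun-neg M (termFun B M j t (ℕₚ.≤-trans (ℕₚ.+-monoʳ-≤ j (ℕₚ.n≤1+n _)) l)))
  termFun B M j σ⟨ t ⟩ l = PolyFun-weaken M (double-mono (ℕₚ.n≤1+n _))
    (termFun B M (suc j) t (ℕₚ.≤-trans (ℕₚ.≤-reflexive (≡.sym (ℕₚ.+-suc j _))) l))
  termFun B M j (s ⊕ t) l = PolyFun-+ M
    (PolyFun-weaken M (double-mono (ℕₚ.m≤n⇒m≤1+n (ℕₚ.m≤m+n ∣ s ∣ᵗ _)))
      (termFun B M j s (ℕₚ.≤-trans (ℕₚ.+-monoʳ-≤ j (ℕₚ.m≤n⇒m≤1+n (ℕₚ.m≤m+n ∣ s ∣ᵗ _))) l)))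
    (PolyFun-weaken M (double-mono (ℕₚ.m≤n⇒m≤1+n (ℕₚ.m≤n+m ∣ t ∣ᵗ ∣ s ∣ᵗ)))
      (termFun B M j t (ℕₚ.≤-trans (ℕₚ.+-monoʳ-≤ j (ℕₚ.m≤n⇒m≤1+n (ℕₚ.m≤n+m ∣ t ∣ᵗ ∣ s ∣ᵗ))) l)))
  termFun B M j (s ⊗ t) l = PolyFun-weaken M (double-+ ∣ s ∣ᵗ ∣ t ∣ᵗ)
    (PolyFun-* M
      (termFun B M j s (ℕₚ.≤-trans (ℕₚ.+-monoʳ-≤ j (ℕₚ.m≤n⇒m≤1+n (ℕₚ.m≤m+n ∣ s ∣ᵗ _))) l))
      (termFun B M j t (ℕₚ.≤-trans (ℕₚ.+-monoʳ-≤ j (ℕₚ.m≤n⇒m≤1+n (ℕₚ.m≤n+m ∣ t ∣ᵗ ∣ s ∣ᵗ))) l)))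

-- Generic points for the Frobenius map in one large field

module FrobeniusGenericity (em : ExcludedMiddle 0ℓ) (K : Field) (p : ℕ) .{{_ : ℕ.NonZero p}} where
  open List.List using ([]; _∷_)
  open FilterProperties
  open Field K hiding (zero)
  open UnivariatePolynomials K
  open SequenceSemantics K
  open PolynomialFunctions K

  frobeniusOrbit : Carrier → Sequence
  frobeniusOrbit = orbit (_^ p)

  -- The base-`p` digits of an exponent below `p ^ M` are the degrees in x, x ^ p, x ^ p², and so
  -- on; distinct monomials therefore get distinct exponents. Hence the coefficients of the
  -- univariate polynomial control `G` on all sequences and not only on Frobenius orbits.
  kronecker : ∀ M {G} → PolyFun M p G → Σ (ℕ → Carrier) λ c →
    (∀ x → G (frobeniusOrbit x) ≈ horner (p ℕ.^ M) c x) ×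
    ((∀ m → m ℕ.< p ℕ.^ M → c m ≈ 0#) → ∀ A → G A ≈ 0#)
  kronecker zero (c , G≈c) = (λ _ → c) ,
    (λ x → trans (G≈c _) (sym (trans (+-congˡ (zeroʳ x)) (+-identityʳ c)))) ,
    λ c≈0 A → trans (G≈c A) (c≈0 0 (s≤s z≤n))
  kronecker (suc M) {G} (layer g q G≈) = d , agrees , vanish
    where
    c = λ i → proj₁ (kronecker M (q i))
    d : ℕ → Carrier
    d m = c (m % p) (m / p)
    agrees : ∀ x → G (frobeniusOrbit x) ≈ horner (p ℕ.^ suc M) d x
    agrees x = trans (G≈ _) (trans
      (horner-cong p (λ i _ → proj₁ (proj₂ (kronecker M (q i))) (x ^ p)) x)
      (trans (horner-interleave p (p ℕ.^ M) c x)
        (reflexive (≡.cong (λ L → horner L d x) (ℕₚ.*-comm (p ℕ.^ M) p)))))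
    vanish : (∀ m → m ℕ.< p ℕ.^ suc M → d m ≈ 0#) → ∀ A → G A ≈ 0#
    vanish d≈0 A = trans (G≈ A) (horner-0 p (λ i i<p →
      proj₂ (proj₂ (kronecker M (q i))) (λ m m<pᴹ →
        trans (reflexive (≡.sym (≡.cong₂ c (digit₀ i<p m) (digits i<p m)))) (d≈0 (i ℕ.+ m ℕ.* p) (bound i<p m<pᴹ)))
        (A ∘ suc)) (A 0))
      where
      digit₀ : ∀ {i} → i ℕ.< p → ∀ m → (i ℕ.+ m ℕ.* p) % p ≡ i
      digit₀ {i} i<p m = ≡.trans ([m+kn]%n≡m%n i m p) (m<n⇒m%n≡m i<p)
      digits : ∀ {i} → i ℕ.< p → ∀ m → (i ℕ.+ m ℕ.* p) / p ≡ m
      digits {i} i<p m = ≡.trans (+-distrib-/-∣ʳ i (ℕ∣.n∣m*n m)) (≡.cong₂ ℕ._+_ (m<n⇒m/n≡0 i<p) (m*n/n≡m m p))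
      bound : ∀ {i m} → i ℕ.< p → m ℕ.< p ℕ.^ M → i ℕ.+ m ℕ.* p ℕ.< p ℕ.^ suc M
      bound {i} {m} i<p m<pᴹ = ℕₚ.<-≤-trans (ℕₚ.+-monoˡ-< (m ℕ.* p) i<p)
        (ℕₚ.≤-trans (ℕₚ.*-monoˡ-≤ p m<pᴹ) (ℕₚ.≤-reflexive (ℕₚ.*-comm (p ℕ.^ M) p)))

  -- The length condition keeps the degree in every entry below `p`, as the Kronecker substitution
  -- requires. Every fixed term meets it once `p` is large.
  Generic : Sequence → Pred (σTerm 2) 0ℓ → Carrier → Set
  Generic B T a = ∀ t → T t → ∣ t ∣ᵗ ℕ.+ ∣ t ∣ᵗ ℕ.≤ p →
    ⟦ t ⟧ˢ ⟨ frobeniusOrbit a , B ⟩ 0 ≈ 0# → ∀ A → ⟦ t ⟧ˢ ⟨ A , B ⟩ 0 ≈ 0#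

  -- A term this short involves at most the first `p` entries, so its univariate form has `p ^ p`
  -- coefficients, and as many distinct roots annihilate it.
  few-roots : ∀ B t → ∣ t ∣ᵗ ℕ.+ ∣ t ∣ᵗ ℕ.≤ p → ∀ {xs} → Distinct xs → p ℕ.^ p ℕ.≤ length xs →
    All (λ x → ⟦ t ⟧ˢ ⟨ frobeniusOrbit x , B ⟩ 0 ≈ 0#) xs → ∀ A → ⟦ t ⟧ˢ ⟨ A , B ⟩ 0 ≈ 0#
  few-roots B t 2∣t∣≤p distinct pᵖ≤ roots
    with kronecker p (PolyFun-weaken p 2∣t∣≤p (termFun B p 0 t (ℕₚ.m+n≤o⇒m≤o _ 2∣t∣≤p)))
  ... | c , agrees , vanish = vanish (coefficients≈0 (p ℕ.^ p) c distinct pᵖ≤ (All.map (λ {x} → trans (sym (agrees x))) roots))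

  -- Terms are treated one at a time: one that is short enough and not identically zero removes at
  -- most `p ^ p` candidates, while any other imposes no condition.
  generic-exists : ∀ B ts xs → Distinct xs → length ts ℕ.* p ℕ.^ p ℕ.< length xs →
    Σ Carrier λ a → a ∈ xs × Generic B (_∈ ts) a
  generic-exists B []       (x ∷ xs) distinct _ = x , here ≡.refl , λ _ ()
  generic-exists B (t ∷ ts) xs distinct l = extend em
    where
    Root : Pred Carrier 0ℓ
    Root x = ⟦ t ⟧ˢ ⟨ frobeniusOrbit x , B ⟩ 0 ≈ 0#
    root? : Decidable Root
    root? _ = em
    nonroots = filter (¬? ∘ root?) xs
    roots = filter root? xs

    Effective : Set
    Effective = ∣ t ∣ᵗ ℕ.+ ∣ t ∣ᵗ ℕ.≤ p × ¬ (∀ A → ⟦ t ⟧ˢ ⟨ A , B ⟩ 0 ≈ 0#)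

    extend : Dec Effective → Σ Carrier λ a → a ∈ xs × Generic B (_∈ (t ∷ ts)) a
    extend (yes (2∣t∣≤p , t≉0)) with generic-exists B ts nonroots (AllPairsₚ.filter⁺ (¬? ∘ root?) distinct) l′
      where
      few : length roots ℕ.≤ p ℕ.^ p
      few = ℕₚ.<⇒≤ (ℕₚ.≰⇒> λ pᵖ≤ →
        t≉0 (few-roots B t 2∣t∣≤p (AllPairsₚ.filter⁺ root? distinct) pᵖ≤ (Allₚ.all-filter root? xs)))
      l′ : length ts ℕ.* p ℕ.^ p ℕ.< length nonroots
      l′ = ℕₚ.+-cancelˡ-< (p ℕ.^ p) _ _ (ℕₚ.<-≤-trans l (ℕₚ.≤-trans
        (ℕₚ.≤-reflexive (≡.sym (length-filter-¬ root? xs))) (ℕₚ.+-monoˡ-≤ _ few)))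
    ... | a , a∈ , generic with ∈-filter⁻ (¬? ∘ root?) {xs = xs} a∈
    ... | a∈xs , a-nonroot = a , a∈xs , λ
      { _ (here ≡.refl) _ e → contradiction e a-nonroot
      ; s (there s∈ts) → generic s s∈ts }
    extend (no ¬effective) with generic-exists B ts xs distinct (ℕₚ.≤-<-trans (ℕₚ.m≤n+m _ (p ℕ.^ p)) l)
    ... | a , a∈xs , generic = a , a∈xs , λ
      { _ (here ≡.refl) 2∣t∣≤p _ → decidable-stable em λ t≉0 → ¬effective (2∣t∣≤p , t≉0)
      ; s (there s∈ts) → generic s s∈ts }

-- Finite sets, and finite fields with p ^ (2 ^ m) elements

module FiniteSetoids (S : Setoid 0ℓ 0ℓ) where
  open Setoid S

  hasCard : ∀ {q} (to : Fin q → Carrier) → (∀ {i j} → to i ≈ to j → i ≡ j) →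
    (∀ x → ∃ λ i → to i ≈ x) → HasCard S q
  hasCard to injective surjective = record
    { to        = to
    ; from      = proj₁ ∘ surjective
    ; to-cong   = λ { ≡.refl → refl }
    ; from-cong = λ {x} {y} x≈y →
        injective (trans (proj₂ (surjective x)) (trans x≈y (sym (proj₂ (surjective y)))))
    ; inverse   = (λ { {x} ≡.refl → proj₂ (surjective x) })
                , λ {i} {x} x≈ → injective (trans (proj₂ (surjective x)) x≈)
    }

  private
    -- Punching out an omitted value would give an injection into a smaller `Fin`.
    injective⇒surjective-Fin : ∀ {q} (s : Fin q → Fin q) → (∀ {i j} → s i ≡ s j → i ≡ j) →
      ∀ i → ∃ λ j → s j ≡ i
    injective⇒surjective-Fin {suc q} s injective i =
      decidable-stable (Finₚ.any? λ j → s j Finₚ.≟ i) λ omitted →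
        ℕₚ.1+n≰n (Finₚ.injective⇒≤ {f = λ j → Fin.punchOut {i = i} (λ e → omitted (j , ≡.sym e))}
          λ e → injective (Finₚ.punchOut-injective (λ e → omitted (_ , ≡.sym e)) (λ e → omitted (_ , ≡.sym e)) e))

  module _ {q} (card : HasCard S q) where
    open Inverse card using (to; from; from-cong; strictlyInverseˡ; strictlyInverseʳ)

    to-injective : ∀ {i j} → to i ≈ to j → i ≡ j
    to-injective {i} {j} e = ≡.trans (≡.sym (strictlyInverseʳ i)) (≡.trans (from-cong e) (strictlyInverseʳ j))

    -- A section of `g` is injective, hence onto by finiteness, so every index is the chosen
    -- preimage of its own value. With domain `Fin q` the map `g` may involve `_⁻¹`, which is not
    -- assumed to respect `≈`.
    surjective⇒injective : (g : Fin q → Carrier) → (∀ x → ∃ λ i → g i ≈ x) →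
      ∀ {i j} → g i ≈ g j → i ≡ j
    surjective⇒injective g surjective {i} {j} gi≈gj
      with injective⇒surjective-Fin section section-injective i | injective⇒surjective-Fin section section-injective j
      where
      section : Fin q → Fin q
      section k = proj₁ (surjective (to k))
      section-injective : ∀ {k l} → section k ≡ section l → k ≡ l
      section-injective {k} {l} e = to-injective (trans (sym (proj₂ (surjective (to k))))
        (trans (reflexive (≡.cong g e)) (proj₂ (surjective (to l)))))
    ... | k , ≡.refl | l , ≡.refl = ≡.cong (proj₁ ∘ surjective ∘ to) (to-injective
      (trans (sym (proj₂ (surjective (to k)))) (trans gi≈gj (proj₂ (surjective (to l))))))

    injective⇒surjective : (g : Carrier → Carrier) → (∀ {x y} → g x ≈ g y → x ≈ y) →
      ∀ y → ∃ λ x → g x ≈ y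
    injective⇒surjective g injective y with injective⇒surjective-Fin (from ∘ g ∘ to)
      (λ e → to-injective (injective (from-injective e))) (from y)
      where
      from-injective : ∀ {x y} → from x ≡ from y → x ≈ y
      from-injective {x} {y} e = trans (sym (strictlyInverseˡ x)) (trans (reflexive (≡.cong to e)) (strictlyInverseˡ y))
    ... | i , e = to i , trans (sym (strictlyInverseˡ _)) (trans (reflexive (≡.cong to e)) (strictlyInverseˡ y))

CharacteristicDivides : ℕ → Field → Set
CharacteristicDivides p K = p · 1# ≈ 0#
  where open Field K

module IntegersModulo (p : ℕ) (p-prime : Prime p) where
  instance _ = prime⇒nonZero p-prime

  infix 4 _≈_
  record _≈_ (x y : ℤ) : Set where
    constructor congruent
    field p∣x-y : + p ℤ∣.∣ x ℤ.- y
  open _≈_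

  private
    via : ∀ {x y d} → d ≡ x ℤ.- y → + p ℤ∣.∣ d → x ≈ y
    via ≡.refl = congruent

    reflexive : ∀ {x y} → x ≡ y → x ≈ y
    reflexive {x} ≡.refl = via {x} {x} (≡.sym (ℤₚ.+-inverseʳ x)) (ℤ∣.divides (+ 0) ≡.refl)

  ring : CommutativeRing 0ℓ 0ℓ
  ring = record
    { Carrier = ℤ ; _≈_ = _≈_ ; _+_ = ℤ._+_ ; _*_ = ℤ._*_ ; -_ = ℤ.-_ ; 0# = + 0 ; 1# = + 1
    ; isCommutativeRing = record
      { isRing = record
        { +-isAbelianGroup = record
          { isGroup = record
            { isMonoid = record
              { isSemigroup = record
                { isMagma = record
                  { isEquivalence = record
                    { refl  = reflexive ≡.refl
                    ; sym   = λ {x} {y} e → via (sym-eq x y) (ℤ∣.∣m⇒∣-m (p∣x-y e))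
                    ; trans = λ {x} {y} {z} e f → via (trans-eq x y z) (ℤ∣.∣m∣n⇒∣m+n (p∣x-y e) (p∣x-y f))
                    }
                  ; ∙-cong = λ {x} {y} {u} {v} e f → via (+-eq x y u v) (ℤ∣.∣m∣n⇒∣m+n (p∣x-y e) (p∣x-y f))
                  }
                ; assoc = λ x y z → reflexive (ℤₚ.+-assoc x y z)
                }
              ; identity = reflexive ∘ ℤₚ.+-identityˡ , reflexive ∘ ℤₚ.+-identityʳ
              }
            ; inverse = reflexive ∘ ℤₚ.+-inverseˡ , reflexive ∘ ℤₚ.+-inverseʳ
            ; ⁻¹-cong = λ {x} {y} e → via (neg-eq x y) (ℤ∣.∣m⇒∣-m (p∣x-y e))
            }
          ; comm = λ x y → reflexive (ℤₚ.+-comm x y)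
          }
        ; *-cong = λ {x} {y} {u} {v} e f → via (*-eq x y u v) (ℤ∣.∣m∣n⇒∣m+n (ℤ∣.∣m⇒∣m*n u (p∣x-y e)) (ℤ∣.∣n⇒∣m*n y (p∣x-y f)))
        ; *-assoc = λ x y z → reflexive (ℤₚ.*-assoc x y z)
        ; *-identity = reflexive ∘ ℤₚ.*-identityˡ , reflexive ∘ ℤₚ.*-identityʳ
        ; distrib = (λ x y z → reflexive (ℤₚ.*-distribˡ-+ x y z)) , (λ x y z → reflexive (ℤₚ.*-distribʳ-+ x y z))
        }
      ; *-comm = λ x y → reflexive (ℤₚ.*-comm x y)
      }
    }
    where
    sym-eq : ∀ x y → ℤ.- (x ℤ.- y) ≡ y ℤ.- x
    sym-eq = solve-∀
    trans-eq : ∀ x y z → (x ℤ.- y) ℤ.+ (y ℤ.- z) ≡ x ℤ.- z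
    trans-eq = solve-∀
    +-eq : ∀ x y u v → (x ℤ.- y) ℤ.+ (u ℤ.- v) ≡ (x ℤ.+ u) ℤ.- (y ℤ.+ v)
    +-eq = solve-∀
    *-eq : ∀ x y u v → (x ℤ.- y) ℤ.* u ℤ.+ y ℤ.* (u ℤ.- v) ≡ (x ℤ.* u) ℤ.- (y ℤ.* v)
    *-eq = solve-∀
    neg-eq : ∀ x y → ℤ.- (x ℤ.- y) ≡ (ℤ.- x) ℤ.- (ℤ.- y)
    neg-eq = solve-∀

  private
    ≈-sym : ∀ {x y} → x ≈ y → y ≈ x
    ≈-sym = CommutativeRing.sym ring

    residue : ∀ x → + (x ℤDivMod.%ℕ p) ≈ x
    residue x = ≈-sym (congruent (ℤ∣.divides (x ℤDivMod./ℕ p)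
      (≡.trans (≡.cong (ℤ._- + r) (ℤDivMod.a≡a%ℕn+[a/ℕn]*n x p)) (cancel (+ r) _))))
      where
      r = x ℤDivMod.%ℕ p
      cancel : ∀ a b → (a ℤ.+ b) ℤ.- a ≡ b
      cancel = solve-∀

    pos-injective : ∀ {r s} → r ℕ.< p → s ℕ.< p → + r ≈ + s → r ≡ s
    pos-injective {r} {s} r<p s<p e = ℤₚ.+-injective (ℤₚ.i-j≡0⇒i≡j (+ r) (+ s)
      (ℤₚ.∣i∣≡0⇒i≡0 (decidable-stable (_ ℕₚ.≟ 0) λ ≢0 →
        ℕₚ.<⇒≱ (ℕₚ.≤-<-trans bound (ℕₚ.⊔-lub r<p s<p)) (ℕ∣.∣⇒≤ {{ℕ.≢-nonZero ≢0}} (ℤ∣.∣⇒∣ᵤ (p∣x-y e))))))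
      where
      bound : ℤ.∣ + r ℤ.- + s ∣ ℕ.≤ r ℕ.⊔ s
      bound = ≡.subst (ℕ._≤ r ℕ.⊔ s) (≡.cong ℤ.∣_∣ (≡.sym (ℤₚ.m-n≡m⊖n r s))) (ℤₚ.∣m⊝n∣≤m⊔n r s)

    residue-inverse : ∀ r → .{{ℕ.NonZero r}} → r ℕ.< p → ∃ λ y → + r ℤ.* y ≈ + 1
    residue-inverse r r<p with coprime-Bézout (prime⇒coprime p-prime r<p)
    ... | Bézout.-+ u v e = + v , congruent (ℤ∣.divides (+ u) (≡.trans (≡.cong (ℤ._- + 1) (begin
      + r ℤ.* + v            ≡⟨ ℤₚ.*-comm (+ r) (+ v) ⟩
      + v ℤ.* + r            ≡⟨ ℤₚ.pos-* v r ⟨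
      + (v ℕ.* r)            ≡⟨ ≡.cong +_ e ⟨
      + 1 ℤ.+ + (u ℕ.* p)    ≡⟨ ≡.cong (λ z → + 1 ℤ.+ z) (ℤₚ.pos-* u p) ⟩
      + 1 ℤ.+ + u ℤ.* + p    ∎)) (cancel (+ u ℤ.* + p))))
      where
      open ≡.≡-Reasoning
      cancel : ∀ a → (+ 1 ℤ.+ a) ℤ.- + 1 ≡ a
      cancel = solve-∀
    ... | Bézout.+- u v e = ℤ.- + v , congruent (ℤ∣.divides (ℤ.- + u) (begin
      + r ℤ.* ℤ.- + v ℤ.- + 1         ≡⟨ rearrange (+ r) (+ v) ⟩
      ℤ.- (+ 1 ℤ.+ + v ℤ.* + r)       ≡⟨ ≡.cong (λ z → ℤ.- (+ 1 ℤ.+ z)) (ℤₚ.pos-* v r) ⟨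
      ℤ.- (+ (1 ℕ.+ v ℕ.* r))         ≡⟨ ≡.cong (ℤ.-_ ∘ +_) e ⟩
      ℤ.- (+ (u ℕ.* p))               ≡⟨ ≡.cong ℤ.-_ (ℤₚ.pos-* u p) ⟩
      ℤ.- (+ u ℤ.* + p)               ≡⟨ ℤₚ.neg-distribˡ-* (+ u) (+ p) ⟩
      ℤ.- + u ℤ.* + p                 ∎))
      where
      open ≡.≡-Reasoning
      rearrange : ∀ r v → r ℤ.* ℤ.- v ℤ.- + 1 ≡ ℤ.- (+ 1 ℤ.+ v ℤ.* r)
      rearrange = solve-∀

    inverse : ∀ x → ¬ x ≈ + 0 → ∃ λ y → x ℤ.* y ≈ + 1
    inverse x x≉0 with residue-inverse (x ℤDivMod.%ℕ p)
      {{ℕ.≢-nonZero λ r≡0 → x≉0 (≈-sym (≡.subst (λ r → + r ≈ x) r≡0 (residue x)))}}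
      (ℤDivMod.n%ℕd<d x p)
    ... | y , ry≈1 = y , trans (*-congʳ (≈-sym (residue x))) ry≈1
      where open CommutativeRing ring using (trans; *-congʳ)

    inverse-if-nonzero : ∀ x → ∃ λ y → ¬ x ≈ + 0 → x ℤ.* y ≈ + 1
    inverse-if-nonzero x with + p ℤ∣.∣? x ℤ.- + 0
    -- Inversion must be total; on multiples of `p` the value 0 is a default.
    ... | yes x≈0 = + 0 , λ x≉0 → contradiction (congruent x≈0) x≉0
    ... | no  x≉0 = proj₁ (inverse x (x≉0 ∘ p∣x-y)) , λ _ → proj₂ (inverse x (x≉0 ∘ p∣x-y))

  field-ℤ/p : Field
  field-ℤ/p = record
    { commutativeRing = ring
    ; _⁻¹             = proj₁ ∘ inverse-if-nonzero
    ; *-inverse       = proj₂ ∘ inverse-if-nonzero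
    ; 0≉1             = λ e → case pos-injective (ℕ.>-nonZero⁻¹ p) (ℕ.nonTrivial⇒n>1 p) e of λ ()
    }
    where instance _ = prime⇒nonTrivial p-prime

  hasCard-p : HasCard (Field.setoid field-ℤ/p) p
  hasCard-p = FiniteSetoids.hasCard (Field.setoid field-ℤ/p) (+_ ∘ toℕ)
    (λ {i} {j} → Finₚ.toℕ-injective ∘ pos-injective (Finₚ.toℕ<n i) (Finₚ.toℕ<n j))
    λ x → Fin.fromℕ< (ℤDivMod.n%ℕd<d x p) ,
      ≡.subst (λ r → + r ≈ x) (≡.sym (Finₚ.toℕ-fromℕ< (ℤDivMod.n%ℕd<d x p))) (residue x)

  characteristic-p : CharacteristicDivides p field-ℤ/p
  characteristic-p = ≡.subst (_≈ + 0) (≡.sym (n·1≡n p)) (congruent (ℤ∣.divides (+ 1) (cancel (+ p))))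
    where
    open Field field-ℤ/p using (_·_)
    n·1≡n : ∀ n → n · + 1 ≡ + n
    n·1≡n zero    = ≡.refl
    n·1≡n (suc n) = ≡.cong (λ z → + 1 ℤ.+ z) (n·1≡n n)
    cancel : ∀ a → a ℤ.- + 0 ≡ + 1 ℤ.* a
    cancel = solve-∀

-- A member of `𝒮` has a field at every prime, 2 included. In characteristic 2 squaring a finite
-- field is onto, so X² - a always has a root there; X² - X - a can be made irreducible in every
-- characteristic.
module QuadraticExtension (em : ExcludedMiddle 0ℓ) (K : Field) (q : ℕ) (card : HasCard (Field.setoid K) q) where
  open Field K hiding (zero)
  open FieldProperties K
  open FiniteSetoids setoid
  open Inverse card using (to; from; strictlyInverseˡ)
  open import Algebra.Properties.Ring ring using (x∙y⁻¹≈ε⇒x≈y; x≈y⇒x∙y⁻¹≈ε)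
  open import Relation.Binary.Reasoning.Setoid setoid
  open SemiringSolver commutativeSemiring using (solve; _:=_; _:+_; _:*_; con)

  -- x ↦ x² − x takes the value 0 twice, so it is not surjective.
  nonvalue : ∃ λ a → ∀ x → ¬ x * x ≈ x + a
  nonvalue with em {P = ∃ λ a → ∀ x → ¬ x * x ≈ x + a}
  ... | yes found = found
  ... | no  none  = contradiction 0≈1 0≉1
    where
    g : Fin q → Carrier
    g i = to i * to i - to i
    covers : ∀ y → ∃ λ i → g i ≈ y
    covers y = decidable-stable em λ ¬value → none (y , λ x x²≈x+y → ¬value (from x , (begin
      to (from x) * to (from x) - to (from x)
        ≈⟨ +-cong (*-cong (strictlyInverseˡ x) (strictlyInverseˡ x)) (-‿cong (strictlyInverseˡ x)) ⟩
      x * x - x                                 ≈⟨ +-congʳ x²≈x+y ⟩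
      x + y - x                                 ≈⟨ xyx⁻¹≈y x y ⟩
      y                                         ∎)))
      where open import Algebra.Properties.Ring ring using (xyx⁻¹≈y)
    idempotent-value : ∀ x → x * x ≈ x → g (from x) ≈ 0#
    idempotent-value x x²≈x = x≈y⇒x∙y⁻¹≈ε (trans
      (*-cong (strictlyInverseˡ x) (strictlyInverseˡ x))
      (trans x²≈x (sym (strictlyInverseˡ x))))
    0≈1 : 0# ≈ 1#
    0≈1 = trans (sym (strictlyInverseˡ 0#)) (trans
      (reflexive (≡.cong to (surjective⇒injective card g covers
        (trans (idempotent-value 0# (zeroˡ 0#)) (sym (idempotent-value 1# (*-identityˡ 1#)))))))
      (strictlyInverseˡ 1#))

  a : Carrier
  a = proj₁ nonvalue

  -- (x , y) stands for x + y α, where α² = α + a.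
  additiveGroup : AbelianGroup 0ℓ 0ℓ
  additiveGroup = DirectProduct.abelianGroup +-abelianGroup +-abelianGroup

  private
    module ⊞ = AbelianGroup additiveGroup

    _⊡_ : ⊞.Carrier → ⊞.Carrier → ⊞.Carrier
    (x , y) ⊡ (u , v) = x * u + a * (y * v) , x * v + y * u + y * v

    ⊡-cong : ∀ {x y u v} → x ⊞.≈ y → u ⊞.≈ v → (x ⊡ u) ⊞.≈ (y ⊡ v)
    ⊡-cong (e₁ , e₂) (f₁ , f₂) = +-cong (*-cong e₁ f₁) (*-congˡ (*-cong e₂ f₂))
      , +-cong (+-cong (*-cong e₁ f₂) (*-cong e₂ f₁)) (*-cong e₂ f₂)

    ⊡-comm : ∀ x y → (x ⊡ y) ⊞.≈ (y ⊡ x)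
    ⊡-comm (x , y) (u , v) =
      solve 5 (λ a x y u v → x :* u :+ a :* (y :* v) := u :* x :+ a :* (v :* y)) refl a x y u v ,
      solve 4 (λ x y u v → x :* v :+ y :* u :+ y :* v := u :* y :+ v :* x :+ v :* y) refl x y u v

    ⊡-assoc : ∀ x y z → ((x ⊡ y) ⊡ z) ⊞.≈ (x ⊡ (y ⊡ z))
    ⊡-assoc (x , y) (u , v) (s , t) =
      solve 7 (λ a x y u v s t →
        (x :* u :+ a :* (y :* v)) :* s :+ a :* ((x :* v :+ y :* u :+ y :* v) :* t)
        := x :* (u :* s :+ a :* (v :* t)) :+ a :* (y :* (u :* t :+ v :* s :+ v :* t))) refl a x y u v s t ,
      solve 7 (λ a x y u v s t →
        (x :* u :+ a :* (y :* v)) :* t :+ (x :* v :+ y :* u :+ y :* v) :* s :+ (x :* v :+ y :* u :+ y :* v) :* t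
        := x :* (u :* t :+ v :* s :+ v :* t) :+ y :* (u :* s :+ a :* (v :* t)) :+ y :* (u :* t :+ v :* s :+ v :* t))
        refl a x y u v s t

    ⊡-distribˡ : ∀ x y z → (x ⊡ (y ⊞.∙ z)) ⊞.≈ ((x ⊡ y) ⊞.∙ (x ⊡ z))
    ⊡-distribˡ (x , y) (u , v) (s , t) =
      solve 7 (λ a x y u v s t → x :* (u :+ s) :+ a :* (y :* (v :+ t))
        := x :* u :+ a :* (y :* v) :+ (x :* s :+ a :* (y :* t))) refl a x y u v s t ,
      solve 6 (λ x y u v s t → x :* (v :+ t) :+ y :* (u :+ s) :+ y :* (v :+ t)
        := x :* v :+ y :* u :+ y :* v :+ (x :* t :+ y :* s :+ y :* t)) refl x y u v s t

    ⊡-identityˡ : ∀ x → ((1# , 0#) ⊡ x) ⊞.≈ x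
    ⊡-identityˡ (u , v) =
      solve 3 (λ a u v → con 1 :* u :+ a :* (con 0 :* v) := u) refl a u v ,
      solve 2 (λ u v → con 1 :* v :+ con 0 :* u :+ con 0 :* v := v) refl u v

    ring² : CommutativeRing 0ℓ 0ℓ
    ring² = record
      { Carrier = ⊞.Carrier ; _≈_ = ⊞._≈_ ; _+_ = ⊞._∙_ ; _*_ = _⊡_ ; -_ = ⊞._⁻¹ ; 0# = ⊞.ε ; 1# = 1# , 0#
      ; isCommutativeRing = record
        { isRing = record
          { +-isAbelianGroup = ⊞.isAbelianGroup
          ; *-cong     = ⊡-cong
          ; *-assoc    = ⊡-assoc
          ; *-identity = ⊡-identityˡ , λ x → ⊞.trans (⊡-comm x _) (⊡-identityˡ x)
          ; distrib    = ⊡-distribˡ , λ x y z → ⊞.trans (⊡-comm (y ⊞.∙ z) x)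
              (⊞.trans (⊡-distribˡ x y z) (⊞.∙-cong (⊡-comm x y) (⊡-comm x z)))
          }
        ; *-comm = ⊡-comm
        }
      }

  -- The product of x + y α with its conjugate (x + y) - y α, the other root of the quadratic being
  -- 1 - α. Inverses are conjugates divided by norms.
  norm : Carrier → Carrier → Carrier
  norm x y = x * (x + y) + a * (y * - y)

  norm≈0⇒≈0 : ∀ x y → norm x y ≈ 0# → x ≈ 0# × y ≈ 0#
  norm≈0⇒≈0 x y norm≈0 = x≈0 , y≈0
    where
    -- For y ≉ 0, the quotient z = −x / y satisfies z² = z + a.
    y≈0 : y ≈ 0#
    y≈0 = decidable-stable em λ y≉0 → proj₂ nonvalue (z y≉0) (*-cancelʳ (*-≉0 y≉0 y≉0) (begin
      z y≉0 * z y≉0 * (y * y)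
        ≈⟨ solve 2 (λ z y → z :* z :* (y :* y) := z :* y :* (z :* y)) refl (z y≉0) y ⟩
      z y≉0 * y * (z y≉0 * y)                ≈⟨ *-cong (zy≈-x y≉0) (zy≈-x y≉0) ⟩
      - x * - x                              ≈⟨ [-x]²≈x² ⟩
      x * x                                  ≈⟨ +-identityʳ _ ⟨
      -- The semiring solver treats `- x` and `- y` as atoms, so the vanishing sums x - x and y - y
      -- are inserted here before it regroups.
      x * x + 0#                             ≈⟨ +-congˡ (trans (+-cong (zeroˡ y) (zeroʳ a)) (+-identityʳ 0#)) ⟨
      x * x + (0# * y + a * 0#)
        ≈⟨ +-congˡ (+-cong (*-congʳ (-‿inverseʳ x)) (*-congˡ (trans (*-congˡ (-‿inverseʳ y)) (zeroʳ y)))) ⟨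
      x * x + ((x - x) * y + a * (y * (y - y)))
        ≈⟨ solve 5 (λ a x y x̄ ȳ →
             x :* x :+ ((x :+ x̄) :* y :+ a :* (y :* (y :+ ȳ))) := x :* (x :+ y) :+ a :* (y :* ȳ) :+ (x̄ :* y :+ a :* (y :* y)))
             refl a x y (- x) (- y) ⟩
      norm x y + (- x * y + a * (y * y))     ≈⟨ trans (+-congʳ norm≈0) (+-identityˡ _) ⟩
      - x * y + a * (y * y)                  ≈⟨ +-congʳ (*-congʳ (zy≈-x y≉0)) ⟨
      z y≉0 * y * y + a * (y * y)
        ≈⟨ solve 3 (λ a z y → z :* y :* y :+ a :* (y :* y) := (z :+ a) :* (y :* y)) refl a (z y≉0) y ⟩
      (z y≉0 + a) * (y * y)                  ∎))
      where
      z : ¬ y ≈ 0# → Carrier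
      z _ = - x * y ⁻¹
      zy≈-x : ∀ y≉0 → z y≉0 * y ≈ - x
      zy≈-x y≉0 = trans (*-assoc _ _ _) (trans (*-congˡ (trans (*-comm _ _) (*-inverse y y≉0))) (*-identityʳ _))
      [-x]²≈x² : - x * - x ≈ x * x
      [-x]²≈x² = trans (sym (-‿distribˡ-* x (- x))) (trans (-‿cong (sym (-‿distribʳ-* x x))) (-‿involutive (x * x)))
        where open import Algebra.Properties.Ring ring using (-‿distribˡ-*; -‿distribʳ-*; -‿involutive)
    x≈0 : x ≈ 0#
    x≈0 = decidable-stable em λ x≉0 → *-≉0 x≉0 x≉0 (begin
      x * x                            ≈⟨ solve 2 (λ a x → x :* x := x :* (x :+ con 0) :+ a :* (con 0)) refl a x ⟩
      x * (x + 0#) + a * 0#            ≈⟨ +-cong (*-congˡ (+-congˡ y≈0)) (*-congˡ (trans (*-congʳ y≈0) (zeroˡ (- y)))) ⟨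
      norm x y                         ≈⟨ norm≈0 ⟩
      0#                               ∎)

  private
    inverse : ∀ z → ∃ λ w → ¬ z ⊞.≈ ⊞.ε → (z ⊡ w) ⊞.≈ (1# , 0#)
    inverse (x , y) = (n⁻¹ * (x + y) , n⁻¹ * - y) , λ z≉0 →
        (begin
          x * (n⁻¹ * (x + y)) + a * (y * (n⁻¹ * - y))
            ≈⟨ solve 6 (λ a x y m s ȳ →
                 x :* (m :* s) :+ a :* (y :* (m :* ȳ)) := (x :* s :+ a :* (y :* ȳ)) :* m) refl a x y n⁻¹ (x + y) (- y) ⟩
          norm x y * n⁻¹                               ≈⟨ *-inverse (norm x y) (z≉0 ∘ norm≈0⇒≈0 x y) ⟩
          1#                                           ∎)
      , (begin
          x * (n⁻¹ * - y) + y * (n⁻¹ * (x + y)) + y * (n⁻¹ * - y)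
            ≈⟨ solve 4 (λ x y m ȳ →
                 x :* (m :* ȳ) :+ y :* (m :* (x :+ y)) :+ y :* (m :* ȳ) := m :* (x :+ y) :* (y :+ ȳ)) refl x y n⁻¹ (- y) ⟩
          n⁻¹ * (x + y) * (y - y)                                  ≈⟨ trans (*-congˡ (-‿inverseʳ y)) (zeroʳ _) ⟩
          0#                                                       ∎)
      where n⁻¹ = norm x y ⁻¹

  extension : Field
  extension = record
    { commutativeRing = ring²
    ; _⁻¹             = proj₁ ∘ inverse
    ; *-inverse       = proj₂ ∘ inverse
    ; 0≉1             = 0≉1 ∘ proj₁
    }

  hasCard-q² : HasCard (Field.setoid extension) (q ℕ.* q)
  hasCard-q² = FiniteSetoids.hasCard (Field.setoid extension) to²
    (λ {i} {j} (e₁ , e₂) → ≡.trans (≡.sym (Finₚ.combine-remQuot {q} q i)) (≡.trans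
      (≡.cong₂ Fin.combine (to-injective card e₁) (to-injective card e₂)) (Finₚ.combine-remQuot {q} q j)))
    λ (x , y) → Fin.combine (from x) (from y) ,
      trans (reflexive (≡.cong (to ∘ proj₁) (Finₚ.remQuot-combine (from x) (from y)))) (strictlyInverseˡ x) ,
      trans (reflexive (≡.cong (to ∘ proj₂) (Finₚ.remQuot-combine (from x) (from y)))) (strictlyInverseˡ y)
    where
    to² : Fin (q ℕ.* q) → Carrier × Carrier
    to² i = to (proj₁ (Fin.remQuot {q} q i)) , to (proj₂ (Fin.remQuot {q} q i))

  characteristic-extension : ∀ p → CharacteristicDivides p K → CharacteristicDivides p extension
  characteristic-extension p p·1≈0 = trans (component₁ p) p·1≈0 , component₂ p
    where
    open Field extension using () renaming (_·_ to _·²_; 1# to 1²)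
    component₁ : ∀ n → proj₁ (n ·² 1²) ≈ n · 1#
    component₁ zero    = refl
    component₁ (suc n) = +-congˡ (component₁ n)
    component₂ : ∀ n → proj₂ (n ·² 1²) ≈ 0#
    component₂ zero    = refl
    component₂ (suc n) = trans (+-identityˡ _) (component₂ n)

record FiniteField (p k : ℕ) : Set₁ where
  field
    baseField      : Field
    cardinality    : HasCard (Field.setoid baseField) (p ℕ.^ k)
    characteristic : CharacteristicDivides p baseField

-- Iterated quadratic extensions reach only exponents of the form 2 ^ m, but these exceed any given
-- lower bound.
finiteField : ExcludedMiddle 0ℓ → ∀ {p} → Prime p → ∀ m → FiniteField p (2 ℕ.^ m)
finiteField em {p} p-prime zero = record
  { baseField      = field-ℤ/p
  ; cardinality    = ≡.subst (HasCard _) (≡.sym (ℕₚ.*-identityʳ p)) hasCard-p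
  ; characteristic = characteristic-p
  }
  where open IntegersModulo p p-prime
finiteField em {p} p-prime (suc m) = record
  { baseField      = extension
  ; cardinality    = ≡.subst (HasCard _) (≡.trans (≡.sym (ℕₚ.^-distribˡ-+-* p (2 ℕ.^ m) (2 ℕ.^ m)))
                       (≡.cong (λ k → p ℕ.^ (2 ℕ.^ m ℕ.+ k)) (≡.sym (ℕₚ.+-identityʳ (2 ℕ.^ m))))) hasCard-q²
  ; characteristic = characteristic-extension p K.characteristic
  }
  where
  module K = FiniteField (finiteField em p-prime m)
  open QuadraticExtension em K.baseField (p ℕ.^ (2 ℕ.^ m)) K.cardinality

-- Difference fields and the Frobenius automorphism

module DifferenceFields (M : σField) where
  open σField M hiding (zero)

  record IsAutomorphism : Set where
    field
      σ-+          : ∀ x y → σ (x + y) ≈ σ x + σ y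
      σ-*          : ∀ x y → σ (x * y) ≈ σ x * σ y
      σ-1          : σ 1# ≈ 1#
      σ-surjective : ∀ y → ∃ λ x → σ x ≈ y

  module AutomorphismProperties
    (σ-+ : ∀ x y → σ (x + y) ≈ σ x + σ y) (σ-* : ∀ x y → σ (x * y) ≈ σ x * σ y) (σ-1 : σ 1# ≈ 1#) where
    open FieldProperties baseField
    open import Algebra.Properties.Ring ring
      using (x∙y⁻¹≈ε⇒x≈y; x≈y⇒x∙y⁻¹≈ε; x+x≈x⇒x≈0; +-inverseʳ-unique)

    σ-0 : σ 0# ≈ 0#
    σ-0 = x+x≈x⇒x≈0 (σ 0#) (trans (sym (σ-+ 0# 0#)) (σ-cong (+-identityˡ 0#)))

    σ-neg : ∀ x → σ (- x) ≈ - σ x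
    σ-neg x = +-inverseʳ-unique (σ x) (σ (- x))
      (trans (sym (σ-+ x (- x))) (trans (σ-cong (-‿inverseʳ x)) σ-0))

    σ-≉0 : ∀ {x} → ¬ x ≈ 0# → ¬ σ x ≈ 0#
    σ-≉0 {x} x≉0 σx≈0 = 0≉1 (sym (trans (sym σ-1) (trans (σ-cong (sym (*-inverse x x≉0)))
      (trans (σ-* x (x ⁻¹)) (trans (*-congʳ σx≈0) (zeroˡ _))))))

    σ-injective : ExcludedMiddle 0ℓ → ∀ {x y} → σ x ≈ σ y → x ≈ y
    σ-injective em {x} {y} σx≈σy = x∙y⁻¹≈ε⇒x≈y x y (decidable-stable em λ x-y≉0 → σ-≉0 x-y≉0
      (trans (σ-+ x (- y)) (trans (+-congˡ (σ-neg y)) (x≈y⇒x∙y⁻¹≈ε σx≈σy))))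

    orbit-cong : ∀ {x y} i → x ≈ y → orbit σ x i ≈ orbit σ y i
    orbit-cong zero    x≈y = x≈y
    orbit-cong (suc i) x≈y = orbit-cong i (σ-cong x≈y)

    orbit-+ : ∀ x y i → orbit σ (x + y) i ≈ orbit σ x i + orbit σ y i
    orbit-+ x y zero    = refl
    orbit-+ x y (suc i) = trans (orbit-cong i (σ-+ x y)) (orbit-+ (σ x) (σ y) i)

    orbit-* : ∀ x y i → orbit σ (x * y) i ≈ orbit σ x i * orbit σ y i
    orbit-* x y zero    = refl
    orbit-* x y (suc i) = trans (orbit-cong i (σ-* x y)) (orbit-* (σ x) (σ y) i)

    orbit-neg : ∀ x i → orbit σ (- x) i ≈ - orbit σ x i
    orbit-neg x zero    = refl
    orbit-neg x (suc i) = trans (orbit-cong i (σ-neg x)) (orbit-neg (σ x) i)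

    orbit-0 : ∀ i → orbit σ 0# i ≈ 0#
    orbit-0 zero    = refl
    orbit-0 (suc i) = trans (orbit-cong i σ-0) (orbit-0 i)

    orbit-1 : ∀ i → orbit σ 1# i ≈ 1#
    orbit-1 zero    = refl
    orbit-1 (suc i) = trans (orbit-cong i σ-1) (orbit-1 i)

    orbit-≉0 : ∀ {x} i → ¬ x ≈ 0# → ¬ orbit σ x i ≈ 0#
    orbit-≉0 zero    x≉0 = x≉0
    orbit-≉0 (suc i) x≉0 = orbit-≉0 i (σ-≉0 x≉0)

module FrobeniusOfFiniteField (K : Field) (p : ℕ) (p-prime : Prime p) (p∣char : CharacteristicDivides p K) where
  open Field K hiding (zero)
  open import Relation.Binary.Reasoning.Setoid setoid
  open CommutativeExp commutativeSemiring using (^-distrib-*; ^-congˡ)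
  open SemiringMult semiring using (×-assocˡ; ×-congˡ; ×-congʳ; ×-assoc-*; ×-homo-1)

  p∤k! : ∀ k → k ℕ.< p → ¬ p ∣ k !
  p∤k! zero    0<p p∣1 = ℕ.nonTrivial⇒≢1 {{prime⇒nonTrivial p-prime}} (ℕ∣.∣1⇒≡1 p∣1)
  p∤k! (suc k) k<p p∣ with euclidsLemma (suc k) (k !) p-prime p∣
  ... | inj₁ p∣1+k = ℕₚ.<⇒≱ k<p (ℕ∣.∣⇒≤ p∣1+k)
  ... | inj₂ p∣k!  = p∤k! k (ℕₚ.<⇒≤ k<p) p∣k!

  p∣pCk : ∀ k → 0 ℕ.< k → k ℕ.< p → p ∣ p C k
  p∣pCk k 0<k k<p with euclidsLemma (p C k) (k ! ℕ.* (p ℕ.∸ k) !) p-prime (≡.subst (p ∣_) p!≡ p∣p!)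
    where
    instance
      _ = prime⇒nonZero p-prime
      _ = k ℕₚ.!* (p ℕ.∸ k) !≢0
    p∣p! : p ∣ p !
    p∣p! = ℕ∣.∣-trans p∣p′! (ℕ∣.∣-reflexive (≡.cong _! (ℕₚ.suc-pred p)))
      where
      p∣p′! : p ∣ suc (ℕ.pred p) !
      p∣p′! = ≡.subst (_∣ suc (ℕ.pred p) !) (ℕₚ.suc-pred p) (ℕ∣.m∣m*n (ℕ.pred p !))
    p!≡ : p ! ≡ (p C k) ℕ.* (k ! ℕ.* (p ℕ.∸ k) !)
    p!≡ = ≡.sym (≡.trans
      (≡.cong (ℕ._* (k ! ℕ.* (p ℕ.∸ k) !)) (nCk≡n!/k![n-k]! (ℕₚ.<⇒≤ k<p)))
      (m/n*n≡m (k![n∸k]!∣n! (ℕₚ.<⇒≤ k<p))))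
  ... | inj₁ p∣pCk = p∣pCk
  ... | inj₂ p∣k!l! with euclidsLemma (k !) ((p ℕ.∸ k) !) p-prime p∣k!l!
  ... | inj₁ p∣k! = contradiction p∣k! (p∤k! k k<p)
  ... | inj₂ p∣l! = contradiction p∣l! (p∤k! (p ℕ.∸ k) (ℕₚ.∸-monoʳ-< 0<k (ℕₚ.<⇒≤ k<p)))

  d·0≈0 : ∀ d → d · 0# ≈ 0#
  d·0≈0 zero    = refl
  d·0≈0 (suc d) = trans (+-identityˡ _) (d·0≈0 d)

  multiple·x≈0 : ∀ {m} → p ∣ m → ∀ x → m · x ≈ 0#
  multiple·x≈0 {m} (ℕ∣.divides d m≡dp) x = begin
    m · x                   ≈⟨ ×-congˡ m≡dp ⟩
    (d ℕ.* p) · x           ≈⟨ ×-assocˡ x d p ⟨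
    d · (p · x)             ≈⟨ ×-congʳ d p·x≈0 ⟩
    d · 0#                  ≈⟨ d·0≈0 d ⟩
    0#                      ∎
    where
    p·x≈0 : p · x ≈ 0#
    p·x≈0 = begin
      p · x           ≈⟨ ×-congʳ p (*-identityˡ x) ⟨
      p · (1# * x)    ≈⟨ ×-assoc-* p 1# x ⟨
      p · 1# * x      ≈⟨ *-congʳ p∣char ⟩
      0# * x          ≈⟨ zeroˡ x ⟩
      0#              ∎

  private
    -- With `p` presented as a successor the binomial sum splits into its first term, its last term,
    -- and the inner ones, whose coefficients are divisible by `p`.
    frobenius-+′ : ∀ n → p ≡ suc n → ∀ x y → (x + y) ^ p ≈ x ^ p + y ^ p
    frobenius-+′ n ≡.refl x y = begin
      (x + y) ^ p                                       ≈⟨ Binomial.theorem commutativeSemiring p x y ⟩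
      term zero + sum (term ∘ suc)                      ≈⟨ +-congˡ (sum-init-last (term ∘ suc)) ⟩
      term zero + (sum inner + term (suc (Fin.fromℕ n)))  ≈⟨ +-cong first (+-cong inner≈0 last) ⟩
      y ^ p + (0# + x ^ p)                              ≈⟨ trans (+-congˡ (+-identityˡ _)) (+-comm _ _) ⟩
      x ^ p + y ^ p                                     ∎
      where
      open Binomial commutativeSemiring using (binomialTerm)
      open MonoidSum +-monoid using (sum; sum-init-last; sum-cong-≋; sum-replicate-zero)
      term = binomialTerm x y p
      inner = λ i → term (suc (Fin.inject₁ i))
      first : term zero ≈ y ^ p
      first = trans (×-homo-1 _) (*-identityˡ _)
      last : term (suc (Fin.fromℕ n)) ≈ x ^ p
      last = begin
        (p C toℕ k) · (x ^ toℕ k * y ^ (p ℕ.∸ toℕ k))   ≡⟨ ≡.cong (λ k → (p C k) · (x ^ k * y ^ (p ℕ.∸ k))) (Finₚ.toℕ-fromℕ p) ⟩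
        (p C p) · (x ^ p * y ^ (p ℕ.∸ p))               ≡⟨ ≡.cong₂ (λ c m → c · (x ^ p * y ^ m)) (nCn≡1 p) (ℕₚ.n∸n≡0 p) ⟩
        1 · (x ^ p * 1#)                                ≈⟨ trans (×-homo-1 _) (*-identityʳ _) ⟩
        x ^ p                                           ∎
        where k = Fin.fromℕ p
      inner≈0 : sum inner ≈ 0#
      inner≈0 = trans (sum-cong-≋ λ i → multiple·x≈0 (p∣pCk (suc (toℕ (Fin.inject₁ i))) (s≤s z≤n)
        (s≤s (ℕₚ.≤-trans (ℕₚ.≤-reflexive (≡.cong suc (Finₚ.toℕ-inject₁ i))) (Finₚ.toℕ<n i)))) _)
        (sum-replicate-zero n)

  frobenius-+ : ∀ x y → (x + y) ^ p ≈ x ^ p + y ^ p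
  frobenius-+ = frobenius-+′ (ℕ.pred p) (≡.sym (ℕₚ.suc-pred p))
    where instance _ = prime⇒nonZero p-prime

  frobeniusField : σField
  frobeniusField = record { baseField = K ; σ = _^ p ; σ-cong = ^-congˡ p }

  open DifferenceFields frobeniusField

  private
    1^n≈1 : ∀ n → 1# ^ n ≈ 1#
    1^n≈1 zero    = refl
    1^n≈1 (suc n) = trans (*-identityˡ _) (1^n≈1 n)

  module _ {q} (card : HasCard setoid q) where
    open FiniteSetoids setoid
    open FieldProperties K
    open Inverse card using (to; from; strictlyInverseˡ)
    open AutomorphismProperties frobenius-+ (λ x y → ^-distrib-* x y p) (1^n≈1 p)
    open import Algebra.Properties.Ring ring using (x∙y⁻¹≈ε⇒x≈y; x≈y⇒x∙y⁻¹≈ε; -‿involutive)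

    frobenius-isAutomorphism : ExcludedMiddle 0ℓ → IsAutomorphism
    frobenius-isAutomorphism em = record
      { σ-+          = frobenius-+
      ; σ-*          = λ x y → ^-distrib-* x y p
      ; σ-1          = 1^n≈1 p
      ; σ-surjective = injective⇒surjective card (_^ p) (σ-injective em)
      }

    1≉-1 : 2 ℕ.< p → ¬ 1# ≈ - 1#
    1≉-1 2<p 1≈-1 = residue (p % 2) ≡.refl (m%n<n p 2)
      where
      2·1≈0 : 2 · 1# ≈ 0#
      2·1≈0 = trans (+-congˡ (×-homo-1 1#)) (trans (+-congˡ 1≈-1) (-‿inverseʳ 1#))
      residue : ∀ r → p % 2 ≡ r → r ℕ.< 2 → ⊥
      residue zero p%2≡0 _ with prime⇒irreducible p-prime (ℕ∣.m%n≡0⇒n∣m p 2 p%2≡0)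
      ... | inj₂ 2≡p = ℕₚ.<⇒≢ 2<p 2≡p
      residue (suc zero) p%2≡1 _ = 0≉1 (begin
        0#                                  ≈⟨ p∣char ⟨
        p · 1#                              ≈⟨ ×-congˡ (≡.trans (m≡m%n+[m/n]*n p 2) (≡.cong (ℕ._+ p / 2 ℕ.* 2) p%2≡1)) ⟩
        1# + (p / 2 ℕ.* 2) · 1#             ≈⟨ +-congˡ (×-assocˡ 1# (p / 2) 2) ⟨
        1# + (p / 2) · (2 · 1#)             ≈⟨ +-congˡ (trans (×-congʳ (p / 2) 2·1≈0) (d·0≈0 (p / 2))) ⟩
        1# + 0#                             ≈⟨ +-identityʳ 1# ⟩
        1#                                  ∎)
      residue (suc (suc _)) _ (s≤s (s≤s ()))

    -- The map y ↦ σⁿ(y) / y takes the same value at 1 and −1, so it misses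
    -- some value; as it maps 0 to 0, the missed value is not 0.
    nonquotient : ExcludedMiddle 0ℓ → 2 ℕ.< p → ∀ n →
      ∃ λ b → ¬ b ≈ 0# × ∀ y → orbit (_^ p) y n ≈ b * y → y ≈ 0#
    nonquotient em 2<p n with em {P = ∃ λ b → ¬ b ≈ 0# × ∀ y → orbit (_^ p) y n ≈ b * y → y ≈ 0#}
    ... | yes found = found
    ... | no  none  = contradiction (trans (sym (strictlyInverseˡ 1#)) (trans
            (reflexive (≡.cong to (surjective⇒injective card g covers (trans g[1]≈1 (sym g[-1]≈1)))))
            (strictlyInverseˡ (- 1#)))) (1≉-1 2<p)
      where
      g : Fin q → Carrier
      g i = orbit (_^ p) (to i) n * to i ⁻¹
      g≈ : ∀ b i → ¬ to i ≈ 0# → orbit (_^ p) (to i) n ≈ b * to i → g i ≈ b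
      g≈ b i i≉0 e = begin
        orbit (_^ p) (to i) n * to i ⁻¹  ≈⟨ *-congʳ e ⟩
        b * to i * to i ⁻¹               ≈⟨ *-assoc _ _ _ ⟩
        b * (to i * to i ⁻¹)             ≈⟨ trans (*-congˡ (*-inverse (to i) i≉0)) (*-identityʳ b) ⟩
        b                                ∎
      quotient≈ : ∀ b y → ¬ y ≈ 0# → orbit (_^ p) y n ≈ b * y → g (from y) ≈ b
      quotient≈ b y y≉0 e = g≈ b (from y) (y≉0 ∘ trans (sym (strictlyInverseˡ y)))
        (trans (orbit-cong n (strictlyInverseˡ y)) (trans e (*-congˡ (sym (strictlyInverseˡ y)))))
      covers : ∀ b → ∃ λ i → g i ≈ b
      covers b with em {P = b ≈ 0#}
      ... | yes b≈0 = from 0# ,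
        trans (*-congʳ (trans (orbit-cong n (strictlyInverseˡ 0#)) (orbit-0 n))) (trans (zeroˡ _) (sym b≈0))
      ... | no  b≉0 = decidable-stable em λ missed → none (b , b≉0 , λ y e →
        decidable-stable em λ y≉0 → missed (from y , quotient≈ b y y≉0 e))
      1≉0 : ¬ 1# ≈ 0#
      1≉0 = 0≉1 ∘ sym
      g[1]≈1 : g (from 1#) ≈ 1#
      g[1]≈1 = quotient≈ 1# 1# 1≉0 (trans (orbit-1 n) (sym (*-identityˡ 1#)))
      g[-1]≈1 : g (from (- 1#)) ≈ 1#
      g[-1]≈1 = quotient≈ 1# (- 1#) (λ -1≈0 → 1≉0 (trans (sym (-‿involutive 1#)) (trans (-‿cong -1≈0) -0≈0)))
        (trans (orbit-neg 1# n) (trans (-‿cong (orbit-1 n)) (sym (*-identityˡ _))))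
        where
        -0≈0 : - 0# ≈ 0#
        -0≈0 = trans (sym (+-identityˡ _)) (-‿inverseʳ 0#)

-- The Archimedean property of the reals

module CompleteOrderedFieldProperties (ℝ : CompleteOrderedField) where
  open CompleteOrderedField ℝ hiding (zero)
  open import Algebra.Properties.Ring ring using (-‿distribˡ-*; -‿distribʳ-*; -‿involutive)
  private module ≤ = IsTotalOrder isTotalOrder

  ≤-respˡ : ∀ {x y z} → x ≈ y → x ≤ z → y ≤ z
  ≤-respˡ x≈y = ≤.trans (≤.reflexive (sym x≈y))

  ≤-respʳ : ∀ {x y z} → x ≈ y → z ≤ x → z ≤ y
  ≤-respʳ x≈y z≤x = ≤.trans z≤x (≤.reflexive x≈y)

  -- From 1 ≤ 0 follows 0 ≤ -1, hence 0 ≤ (-1)(-1) = 1 and so 0 = 1.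
  1≰0 : ¬ 1# ≤ 0#
  1≰0 1≤0 = 0≉1 (≤.antisym (≤-respʳ [-1]²≈1 (*-nonneg 0≤-1 0≤-1)) 1≤0)
    where
    0≤-1 : 0# ≤ - 1#
    0≤-1 = ≤-respˡ (-‿inverseʳ 1#) (≤-respʳ (+-identityˡ _) (+-monoˡ-≤ (- 1#) 1≤0))
    [-1]²≈1 : - 1# * - 1# ≈ 1#
    [-1]²≈1 = trans (sym (-‿distribˡ-* 1# (- 1#))) (trans (-‿cong (*-identityˡ _)) (-‿involutive 1#))

  0≤1 : 0# ≤ 1#
  0≤1 = [ id , flip contradiction 1≰0 ]′ (≤.total 0# 1#)

  ⌜⌝-mono : ∀ {m n} → m ℕ.≤ n → ⌜ m ⌝ ≤ ⌜ n ⌝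
  ⌜⌝-mono m≤n = mono (ℕₚ.≤⇒≤′ m≤n)
    where
    mono : ∀ {m n} → m ℕ.≤′ n → ⌜ m ⌝ ≤ ⌜ n ⌝
    mono (ℕ.≤′-reflexive ≡.refl) = ≤.refl
    mono {n = suc n} (ℕ.≤′-step m≤n) = ≤.trans (mono m≤n) (≤-respˡ (+-identityˡ _) (+-monoˡ-≤ ⌜ n ⌝ 0≤1))

  -- If `r` bounded all naturals, their supremum s would exist; since n + 1 ≤ s gives n ≤ s - 1,
  -- also s - 1 would be a bound, whence s ≤ s - 1.
  archimedean : ExcludedMiddle 0ℓ → ∀ r → ∃ λ n → r ≤ ⌜ n ⌝
  archimedean em r with em {P = ∃ λ n → r ≤ ⌜ n ⌝}
  ... | yes found = found
  ... | no  none  = contradiction 1≤0 1≰0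
    where
    Naturals : Pred Carrier 0ℓ
    Naturals x = ∃ λ n → x ≈ ⌜ n ⌝
    bounded : UpperBound Naturals r
    bounded x (n , x≈n) = [ (λ r≤n → contradiction (n , r≤n) none) , ≤-respˡ (sym x≈n) ]′ (≤.total r ⌜ n ⌝)
    s = sup Naturals
    nonempty : ∃ Naturals
    nonempty = 0# , 0 , refl
    s-1-bound : UpperBound Naturals (- 1# + s)
    s-1-bound x (n , x≈n) = ≤-respˡ cancel (≤-respʳ (+-comm s (- 1#))
      (+-monoˡ-≤ (- 1#) (sup-upper Naturals nonempty (r , bounded) ⌜ suc n ⌝ (suc n , refl))))
      where
      cancel : ⌜ suc n ⌝ - 1# ≈ x
      cancel = trans (trans (+-congʳ (+-comm 1# ⌜ n ⌝)) (trans (+-assoc _ _ _)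
        (trans (+-congˡ (-‿inverseʳ 1#)) (+-identityʳ _)))) (sym x≈n)
    1≤0 : 1# ≤ 0#
    1≤0 = ≤-respˡ cancelˡ (≤-respʳ cancelʳ (+-monoˡ-≤ (1# - s)
      (sup-least Naturals nonempty (- 1# + s) s-1-bound)))
      where
      cancelˡ : s + (1# - s) ≈ 1#
      cancelˡ = trans (+-congˡ (+-comm 1# (- s))) (trans (sym (+-assoc _ _ _)) (trans (+-congʳ (-‿inverseʳ s)) (+-identityˡ 1#)))
      cancelʳ : - 1# + s + (1# - s) ≈ 0#
      cancelʳ = trans (+-assoc _ _ _) (trans (+-congˡ cancelˡ) (-‿inverseˡ 1#))

-- The cofinite filter on the primes

-- Euclid's argument: a prime factor of N! + 1 cannot divide N!.
primes-unbounded : ∀ N → ∃ λ p → Prime p × N ℕ.< p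
primes-unbounded N = large (factors F) (factorsPrime F) (isFactorisation F)
  where
  open PrimeFactorisation
  F = factorise (suc (N !))
  open List.List using ([]; _∷_)
  large : ∀ ps → All Prime ps → suc (N !) ≡ product ps → ∃ λ p → Prime p × N ℕ.< p
  large []       _              e = contradiction (ℕₚ.suc-injective e) (ℕ.≢-nonZero⁻¹ (N !) {{N ℕₚ.!≢0}})
  large (p ∷ ps) (p-prime All.∷ _) e = p , p-prime , ℕₚ.≰⇒> λ p≤N →
    ℕ.nonTrivial⇒≢1 {{prime⇒nonTrivial p-prime}} (ℕ∣.∣1⇒≡1 (ℕ∣.∣m+n∣m⇒∣n
      (≡.subst (p ∣_) (≡.trans (≡.sym e) (ℕₚ.+-comm 1 (N !))) (ℕ∣.m∣m*n (product ps)))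
      (ℕ∣.∣-trans (p∣p! p {{prime⇒nonZero p-prime}}) (ℕ∣.m≤n⇒m!∣n! p≤N))))
    where
    p∣p! : ∀ p → .{{ℕ.NonZero p}} → p ∣ p !
    p∣p! (suc p) = ℕ∣.m∣m*n (p !)

Cofinite : Pred (Pred ℙ 0ℓ) 0ℓ
Cofinite A = ∃ λ N → ∀ p → N ℕ.< value p → A p

cofinite-isFilter : IsFilter Cofinite
cofinite-isFilter = record
  { full   = 0 , λ _ _ → _
  ; meet   = λ (M , a) (N , b) → M ℕ.⊔ N , λ p M⊔N<p →
      a p (ℕₚ.≤-<-trans (ℕₚ.m≤m⊔n M N) M⊔N<p) , b p (ℕₚ.≤-<-trans (ℕₚ.m≤n⊔m M N) M⊔N<p)
  ; upward = λ A⊆B (N , a) → N , λ p N<p → A⊆B (a p N<p)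
  ; proper = λ (N , empty) → let p , p-prime , N<p = primes-unbounded N in empty (p , [ p-prime ]) N<p
  }

-- The primes above a given `p` form a cofinite set that misses `p`.
cofinite⊆⇒nonprincipal : ∀ {𝓤 : Pred (Pred ℙ 0ℓ) 0ℓ} → (∀ {A} → Cofinite A → 𝓤 A) → ¬ Principal 𝓤
cofinite⊆⇒nonprincipal cofinite⊆𝓤 (p , principal) = ℕₚ.<-irrefl ≡.refl
  (Equivalence.to (principal (λ q → value p ℕ.< value q)) (cofinite⊆𝓤 (value p , λ _ p<q → p<q)))

-- The affine difference equation: degree and definability of its generic solution

orbit-+ₙ : {A : Set} (f : A → A) (x : A) (i j : ℕ) → orbit f x (i ℕ.+ j) ≡ orbit f (orbit f x i) j
orbit-+ₙ f x zero    j = ≡.refl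
orbit-+ₙ f x (suc i) j = orbit-+ₙ f (f x) i j

orbit-suc : {A : Set} (f : A → A) (x : A) (i : ℕ) → f (orbit f x i) ≡ orbit f x (suc i)
orbit-suc f x zero    = ≡.refl
orbit-suc f x (suc i) = orbit-suc f (f x) i

σ^ : ∀ {v} → ℕ → σTerm v → σTerm v
σ^ zero    t = t
σ^ (suc i) t = σ^ i σ⟨ t ⟩

module VanishingPolynomials (M : σField) where
  open List.List using ([]; _∷_)
  open All.All using ([]; _∷_)
  open σField M hiding (zero)
  open UnivariatePolynomials baseField
  open DifferenceAlgebra M
  open import Relation.Binary.Reasoning.Setoid setoid

  evaluate-cong : ∀ n (P : Poly Carrier n) {x y : Vector Carrier n} → (∀ i → x i ≈ y i) → evaluate n P x ≈ evaluate n P y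
  evaluate-cong zero    c        x≈y = refl
  evaluate-cong (suc n) []       x≈y = refl
  evaluate-cong (suc n) (c ∷ cs) x≈y =
    +-cong (evaluate-cong n c (x≈y ∘ suc)) (*-cong (x≈y zero) (evaluate-cong (suc n) cs x≈y))

  module _ {A : Set} (g : A → Carrier) where

    coefficient : List A → ℕ → Carrier
    coefficient []       _       = 0#
    coefficient (c ∷ cs) zero    = g c
    coefficient (c ∷ cs) (suc i) = coefficient cs i

    foldr≈horner : ∀ cs x → foldr (λ c s → g c + x * s) 0# cs ≈ horner (length cs) (coefficient cs) x
    foldr≈horner []       x = refl
    foldr≈horner (c ∷ cs) x = +-congˡ (*-congˡ (foldr≈horner cs x))

    coefficients-vanish : ∀ cs → (∀ i → i ℕ.< length cs → coefficient cs i ≈ 0#) → All (λ c → g c ≈ 0#) cs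
    coefficients-vanish []       _ = []
    coefficients-vanish (c ∷ cs) h = h 0 (s≤s z≤n) ∷ coefficients-vanish cs (λ i → h (suc i) ∘ s≤s)

  -- With all variables but the first fixed, `P` is univariate and has at least as many distinct
  -- roots as coefficients. So its coefficients, polynomials in one variable fewer, vanish at every
  -- point.
  vanishing-polynomial : (∀ L → ∃ λ xs → Distinct xs × L ℕ.≤ length xs) →
    ∀ n (P : Poly Carrier n) → (∀ x → evaluate n P x ≈ 0#) → AllCoefficients (_≈ 0#) n P
  vanishing-polynomial infinite zero    c  P≈0 = P≈0 λ ()
  vanishing-polynomial infinite (suc n) cs P≈0 = All.tabulate λ c∈cs →
    vanishing-polynomial infinite n _ λ y → All.lookup (slice y) c∈cs
    where
    slice : ∀ y → All (λ c → evaluate n c y ≈ 0#) cs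
    slice y with infinite (length cs)
    ... | xs , distinct , l = coefficients-vanish (λ c → evaluate n c y) cs
      (coefficients≈0 (length cs) (coefficient (λ c → evaluate n c y) cs) distinct l
        (All.tabulate λ {x} _ → trans (sym (foldr≈horner (λ c → evaluate n c y) cs x)) (P≈0 (x Vector.∷ y))))

module AffineDifferenceEquation (em : ExcludedMiddle 0ℓ) (M : σField) (automorphism : DifferenceFields.IsAutomorphism M)
  (infinite : ∀ L → ∃ λ xs → UnivariatePolynomials.Distinct (σField.baseField M) xs × L ℕ.≤ length xs)
  (n-1 : ℕ) where
  open List.List using ([]; _∷_)
  open All.All using ([]; _∷_)
  open σField M hiding (zero)
  open DifferenceFields M
  open IsAutomorphism automorphism
  open AutomorphismProperties σ-+ σ-* σ-1
  open SequenceSemantics baseField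
  open FieldProperties baseField
  open DifferenceAlgebra M
  open VanishingPolynomials M
  open import Algebra.Properties.Ring ring using (x∙y⁻¹≈ε⇒x≈y; x≈y⇒x∙y⁻¹≈ε; xyx⁻¹≈y)
  open import Relation.Binary.Reasoning.Setoid setoid
  open SemiringSolver commutativeSemiring using (solve; _:=_; _:+_; _:*_)

  -- As the field is infinite, this says that `a` satisfies no nontrivial difference equation with
  -- coefficients in the ring generated by b, σ b, σ² b, and so on.
  GenericOver : Carrier → Pred Carrier 0ℓ
  GenericOver b a = ∀ t → ⟦ t ⟧ˢ ⟨ orbit σ a , orbit σ b ⟩ 0 ≈ 0# → ∀ A → ⟦ t ⟧ˢ ⟨ A , orbit σ b ⟩ 0 ≈ 0#

  n : ℕ
  n = suc n-1

  module Solution (a b : Carrier) (b≉0 : ¬ b ≈ 0#) (generic : GenericOver b a) where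

    c : Carrier
    c = orbit σ a n - b * a

    t : Vector Carrier n
    t i = orbit σ a (toℕ i)

    parameters : Vector Carrier 2
    parameters = b Vector.∷ c Vector.∷ Vector.[]

    E : Pred Carrier 0ℓ
    E = differenceSubfield (entries parameters)

    x-y+y≈x : ∀ x y → y + (x - y) ≈ x
    x-y+y≈x x y = trans (sym (+-assoc y x (- y))) (xyx⁻¹≈y y x)

    σⁿa≈ba+c : orbit σ a n ≈ b * a + c
    σⁿa≈ba+c = sym (x-y+y≈x _ _)

    IsSolution : Pred Sequence 0ℓ
    IsSolution A = ∀ j → A (n ℕ.+ j) ≈ orbit σ b j * A j + orbit σ c j

    orbit-solution : IsSolution (orbit σ a)
    orbit-solution j = begin
      orbit σ a (n ℕ.+ j)                        ≡⟨ orbit-+ₙ σ a n j ⟩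
      orbit σ (orbit σ a n) j                    ≈⟨ orbit-cong j σⁿa≈ba+c ⟩
      orbit σ (b * a + c) j                      ≈⟨ orbit-+ (b * a) c j ⟩
      orbit σ (b * a) j + orbit σ c j            ≈⟨ +-congʳ (orbit-* b a j) ⟩
      orbit σ b j * orbit σ a j + orbit σ c j    ∎

    -- Every window of n consecutive entries extends to a solution: to the right
    -- by the recurrence, to the left because b is invertible.
    private
      extendʳ : (ℕ → Carrier) → ℕ → ℕ → Carrier
      extendʳ z zero       m = z m
      -- The index drops from `m` to `m ∸ n` and n is positive, so `m` itself is always enough fuel.
      extendʳ z (suc fuel) m with m ℕₚ.<? n
      ... | yes _ = z m
      ... | no  _ = orbit σ b (m ℕ.∸ n) * extendʳ z fuel (m ℕ.∸ n) + orbit σ c (m ℕ.∸ n)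

    solution-through : ∀ N (z : ℕ → Carrier) → ∃ λ A → IsSolution A × ∀ i → i ℕ.< n → A (i ℕ.+ N) ≈ z i
    solution-through zero z = (λ m → extendʳ z m m) , solution , window
      where
      fuel-irrelevant : ∀ f g m → m ℕ.≤ f → m ℕ.≤ g → extendʳ z f m ≡ extendʳ z g m
      fuel-irrelevant zero    zero    m _ _ = ≡.refl
      fuel-irrelevant zero    (suc g) m z≤n _ = ≡.refl
      fuel-irrelevant (suc f) zero    m _ z≤n = ≡.refl
      fuel-irrelevant (suc f) (suc g) m m≤f m≤g with m ℕₚ.<? n
      ... | yes _ = ≡.refl
      ... | no  _ = ≡.cong (λ x → orbit σ b (m ℕ.∸ n) * x + orbit σ c (m ℕ.∸ n))
        (fuel-irrelevant f g (m ℕ.∸ n) (smaller m≤f) (smaller m≤g))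
        where
        smaller : ∀ {m f} → m ℕ.≤ suc f → m ℕ.∸ n ℕ.≤ f
        smaller {zero}  _         = z≤n
        smaller {suc m} (s≤s m≤f) = ℕₚ.≤-trans (ℕₚ.m∸n≤m m n-1) m≤f
      solution : IsSolution (λ m → extendʳ z m m)
      solution j with n ℕ.+ j ℕₚ.<? n
      ... | yes n+j<n = contradiction (ℕₚ.m≤m+n n j) (ℕₚ.<⇒≱ n+j<n)
      ... | no  _ rewrite ℕₚ.m+n∸m≡n n-1 j =
        reflexive (≡.cong (λ x → orbit σ b j * x + orbit σ c j) (fuel-irrelevant _ j j (ℕₚ.m≤n+m j n-1) ℕₚ.≤-refl))
      window : ∀ i → i ℕ.< n → extendʳ z (i ℕ.+ 0) (i ℕ.+ 0) ≈ z i
      window i i<n rewrite ℕₚ.+-identityʳ i = initial i i<n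
        where
        initial : ∀ i → i ℕ.< n → extendʳ z i i ≈ z i
        initial zero    _ = refl
        initial (suc i) i<n with suc i ℕₚ.<? n
        ... | yes _   = refl
        ... | no  i≮n = contradiction i<n i≮n
    -- The window moves one place to the left. Its new first entry is the one for which the
    -- recurrence at `N` produces the prescribed last entry `z n-1`.
    solution-through (suc N) z with solution-through N (λ { zero → orbit σ b N ⁻¹ * (z n-1 - orbit σ c N) ; (suc i) → z i })
    ... | A , solution , A≈ = A , solution , λ i i<n → trans (reflexive (≡.cong A (ℕₚ.+-suc i N))) (window i i<n)
      where
      window : ∀ i → i ℕ.< n → A (suc i ℕ.+ N) ≈ z i
      window i i<n with ℕₚ.m≤n⇒m<n∨m≡n i<n
      ... | inj₁ 1+i<n  = A≈ (suc i) 1+i<n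
      ... | inj₂ ≡.refl = begin
        A (n ℕ.+ N)                                                     ≈⟨ solution N ⟩
        orbit σ b N * A N + orbit σ c N                                 ≈⟨ +-congʳ (*-congˡ (A≈ 0 (s≤s z≤n))) ⟩
        orbit σ b N * (orbit σ b N ⁻¹ * (z n-1 - orbit σ c N)) + orbit σ c N
          ≈⟨ +-congʳ (trans (sym (*-assoc _ _ _)) (trans (*-congʳ (*-inverse _ (orbit-≉0 N b≉0))) (*-identityˡ _))) ⟩
        z n-1 - orbit σ c N + orbit σ c N                               ≈⟨ trans (+-comm _ _) (x-y+y≈x _ _) ⟩
        z n-1                                                           ∎

    -- Think of `h m A` as the value after m applications of σ. From `N` on it is the quotient of
    -- the terms `U` and `W` along solutions. The denominator takes the values σʲ(w), the same for
    -- every solution, and therefore never vanishes on one. The shift `N` is there because terms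
    -- contain σ but not σ⁻¹.
    record RepresentedFrom (N : ℕ) (h : ℕ → Sequence → Carrier) : Set where
      constructor represented
      field
        w   : Carrier
        W U : σTerm 2
        w≉0 : ¬ w ≈ 0#
        W≈  : ∀ A → IsSolution A → ∀ j → ⟦ W ⟧ˢ ⟨ A , orbit σ b ⟩ j ≈ orbit σ w j
        U≈  : ∀ A → IsSolution A → ∀ j → ⟦ U ⟧ˢ ⟨ A , orbit σ b ⟩ j ≈ orbit σ w j * h (N ℕ.+ j) A

    Represented : (ℕ → Sequence → Carrier) → Set
    Represented h = ∃ λ N → RepresentedFrom N h

    raise : ∀ {N h} → RepresentedFrom N h → RepresentedFrom (suc N) h
    raise {N} {h} (represented w W U w≉0 W≈ U≈) = represented (σ w) σ⟨ W ⟩ σ⟨ U ⟩ (σ-≉0 w≉0)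
      (λ A s j → W≈ A s (suc j))
      λ A s j → trans (U≈ A s (suc j)) (*-congˡ (reflexive (≡.cong (λ m → h m A) (ℕₚ.+-suc N j))))

    raise* : ∀ {N h} k → RepresentedFrom N h → RepresentedFrom (k ℕ.+ N) h
    raise* zero    r = r
    raise* (suc k) r = raise (raise* k r)

    combine : ∀ {h₁ h₂ h} → (∀ {N} → RepresentedFrom N h₁ → RepresentedFrom N h₂ → RepresentedFrom N h) →
      Represented h₁ → Represented h₂ → Represented h
    combine {h₂ = h₂} f (N₁ , r₁) (N₂ , r₂) = N₂ ℕ.+ N₁ , f (raise* N₂ r₁)
      (≡.subst (λ N → RepresentedFrom N h₂) (ℕₚ.+-comm N₁ N₂) (raise* N₁ r₂))

    represented-resp : ∀ {h h′} → (∀ N A → h N A ≈ h′ N A) → Represented h → Represented h′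
    represented-resp h≈h′ (N , represented w W U w≉0 W≈ U≈) =
      N , represented w W U w≉0 W≈ λ A s j → trans (U≈ A s j) (*-congˡ (h≈h′ _ A))

    represented-term : ∀ {h} U → (∀ A → IsSolution A → ∀ j → ⟦ U ⟧ˢ ⟨ A , orbit σ b ⟩ j ≈ h j A) → Represented h
    represented-term {h} U U≈ = 0 , represented 1# 𝟏 U (0≉1 ∘ sym) (λ A s j → sym (orbit-1 j))
      λ A s j → trans (U≈ A s j) (sym (trans (*-congʳ (orbit-1 j)) (*-identityˡ _)))

    represented-+ : ∀ {h₁ h₂} → Represented h₁ → Represented h₂ → Represented (λ N A → h₁ N A + h₂ N A)
    represented-+ {h₁} {h₂} = combine {h₁} {h₂} λ (represented w₁ W₁ U₁ w₁≉0 W₁≈ U₁≈) (represented w₂ W₂ U₂ w₂≉0 W₂≈ U₂≈) →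
      represented (w₁ * w₂) (W₁ ⊗ W₂) (U₁ ⊗ W₂ ⊕ W₁ ⊗ U₂) (*-≉0 w₁≉0 w₂≉0)
        (λ A s j → trans (*-cong (W₁≈ A s j) (W₂≈ A s j)) (sym (orbit-* w₁ w₂ j)))
        λ A s j → begin
          _  ≈⟨ +-cong (*-cong (U₁≈ A s j) (W₂≈ A s j)) (*-cong (W₁≈ A s j) (U₂≈ A s j)) ⟩
          _
            ≈⟨ solve 4 (λ w h v k →
                 w :* h :* v :+ w :* (v :* k) := w :* v :* (h :+ k)) refl (orbit σ w₁ j) _ (orbit σ w₂ j) _ ⟩
          _  ≈⟨ *-congʳ (orbit-* w₁ w₂ j) ⟨
          _  ∎

    represented-* : ∀ {h₁ h₂} → Represented h₁ → Represented h₂ → Represented (λ N A → h₁ N A * h₂ N A)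
    represented-* {h₁} {h₂} = combine {h₁} {h₂} λ (represented w₁ W₁ U₁ w₁≉0 W₁≈ U₁≈) (represented w₂ W₂ U₂ w₂≉0 W₂≈ U₂≈) →
      represented (w₁ * w₂) (W₁ ⊗ W₂) (U₁ ⊗ U₂) (*-≉0 w₁≉0 w₂≉0)
        (λ A s j → trans (*-cong (W₁≈ A s j) (W₂≈ A s j)) (sym (orbit-* w₁ w₂ j)))
        λ A s j → begin
          _  ≈⟨ *-cong (U₁≈ A s j) (U₂≈ A s j) ⟩
          _  ≈⟨ solve 4 (λ w h v k → w :* h :* (v :* k) := w :* v :* (h :* k)) refl (orbit σ w₁ j) _ (orbit σ w₂ j) _ ⟩
          _  ≈⟨ *-congʳ (orbit-* w₁ w₂ j) ⟨
          _  ∎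

    represented-neg : ∀ {h} → Represented h → Represented (λ N A → - h N A)
    represented-neg (N , represented w W U w≉0 W≈ U≈) = N , represented w W (⊖ U) w≉0 W≈
      λ A s j → trans (-‿cong (U≈ A s j)) (-‿distribʳ-* _ _)
      where open import Algebra.Properties.Ring ring using (-‿distribʳ-*)

    -- Numerator and denominator trade places. The numerator can serve as a denominator because the
    -- represented function is independent of the solution.
    represented-⁻¹ : ∀ {x} → ¬ x ≈ 0# → Represented (λ N _ → orbit σ x N) → Represented (λ N _ → orbit σ (x ⁻¹) N)
    represented-⁻¹ {x} x≉0 (N , represented w W U w≉0 W≈ U≈) =
      N , represented (w * orbit σ x N) U W (*-≉0 w≉0 (orbit-≉0 N x≉0))
        (λ A s j → trans (U≈ A s j) (numerator j))
        λ A s j → trans (W≈ A s j) (begin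
          orbit σ w j                                                       ≈⟨ *-identityʳ _ ⟨
          orbit σ w j * 1#                                                  ≈⟨ *-congˡ (orbit-1 (N ℕ.+ j)) ⟨
          orbit σ w j * orbit σ 1# (N ℕ.+ j)                                ≈⟨ *-congˡ (orbit-cong (N ℕ.+ j) (*-inverse x x≉0)) ⟨
          orbit σ w j * orbit σ (x * x ⁻¹) (N ℕ.+ j)                        ≈⟨ *-congˡ (orbit-* x (x ⁻¹) (N ℕ.+ j)) ⟩
          orbit σ w j * (orbit σ x (N ℕ.+ j) * orbit σ (x ⁻¹) (N ℕ.+ j))    ≈⟨ *-assoc _ _ _ ⟨
          orbit σ w j * orbit σ x (N ℕ.+ j) * orbit σ (x ⁻¹) (N ℕ.+ j)      ≈⟨ *-congʳ (numerator j) ⟩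
          orbit σ (w * orbit σ x N) j * orbit σ (x ⁻¹) (N ℕ.+ j)            ∎)
      where
      numerator : ∀ j → orbit σ w j * orbit σ x (N ℕ.+ j) ≈ orbit σ (w * orbit σ x N) j
      numerator j = trans (*-congˡ (reflexive (orbit-+ₙ σ x N j))) (sym (orbit-* w (orbit σ x N) j))

    ⟦σ^⟧ˢ : ∀ {v} i (t : σTerm v) ρ j → ⟦ σ^ i t ⟧ˢ ρ j ≡ ⟦ t ⟧ˢ ρ (i ℕ.+ j)
    ⟦σ^⟧ˢ zero    t ρ j = ≡.refl
    ⟦σ^⟧ˢ (suc i) t ρ j = ⟦σ^⟧ˢ i σ⟨ t ⟩ ρ j

    represented-entry : ∀ i → Represented (λ N A → A (i ℕ.+ N))
    represented-entry i = represented-term (σ^ i (var zero)) λ A s j → reflexive (⟦σ^⟧ˢ i (var zero) ⟨ A , orbit σ b ⟩ j)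

    -- The parameter c is no variable of the terms, but every solution recovers it as σⁿ(A) - b A.
    -- Only along solutions is this value constant, which is why representations are restricted to
    -- them.
    E-represented : ∀ {x} → E x → Represented (λ N _ → orbit σ x N)
    E-represented (gen (zero , x≈b)) = represented-term (var (suc zero)) λ A s j → orbit-cong j (sym x≈b)
    E-represented (gen (suc zero , x≈c)) = represented-term (σ^ n (var zero) ⊕ ⊖ (var (suc zero) ⊗ var zero)) λ A s j → begin
      ⟦ σ^ n (var zero) ⟧ˢ ⟨ A , orbit σ b ⟩ j - orbit σ b j * A j
        ≈⟨ +-congʳ (trans (reflexive (⟦σ^⟧ˢ n (var zero) ⟨ A , orbit σ b ⟩ j)) (s j)) ⟩
      orbit σ b j * A j + orbit σ c j - orbit σ b j * A j           ≈⟨ xyx⁻¹≈y _ _ ⟩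
      orbit σ c j                                                   ≈⟨ orbit-cong j x≈c ⟨
      orbit σ _ j                                                   ∎
    E-represented (resp x≈y e) = represented-resp (λ N _ → orbit-cong N x≈y) (E-represented e)
    E-represented 0∈ = represented-term 𝟎 λ A s j → sym (orbit-0 j)
    E-represented 1∈ = represented-term 𝟏 λ A s j → sym (orbit-1 j)
    E-represented (+∈ {x} {y} e f) = represented-resp (λ N _ → sym (orbit-+ x y N))
      (represented-+ (E-represented e) (E-represented f))
    E-represented (-∈ {x} e) = represented-resp (λ N _ → sym (orbit-neg x N)) (represented-neg (E-represented e))
    E-represented (*∈ {x} {y} e f) = represented-resp (λ N _ → sym (orbit-* x y N))
      (represented-* (E-represented e) (E-represented f))
    E-represented (⁻¹∈ x≉0 e) = represented-⁻¹ x≉0 (E-represented e)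
    E-represented (step {x} {y} (inj₁ y≈σx) e) = represented-resp (λ N _ → orbit-cong N (sym y≈σx)) (lower (E-represented e))
      where
      lower : Represented (λ N _ → orbit σ x N) → Represented (λ N _ → orbit σ x (suc N))
      -- What represents the iterates of x from `suc N` on represents those of σ x from `N` on.
      lower (N , r) with raise r
      ... | represented w W U w≉0 W≈ U≈ = N , represented w W U w≉0 W≈ U≈
    -- An application of σ⁻¹ is paid for by one more shift; the terms stay the same.
    E-represented (step {x} {y} (inj₂ x≈σy) e) with represented-resp (λ N _ → orbit-cong N x≈σy) (E-represented e)
    ... | N , represented w W U w≉0 W≈ U≈ = suc N , represented w W U w≉0 W≈ U≈

    conjugate : ∀ m → Poly Carrier m → ℕ → Poly Carrier m
    conjugate zero    c  N = orbit σ c N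
    conjugate (suc m) cs N = List.map (λ c → conjugate m c N) cs

    evaluate-conjugate : ∀ m P N (x : Vector Carrier m) →
      evaluate m (conjugate m P N) (λ i → orbit σ (x i) N) ≈ orbit σ (evaluate m P x) N
    evaluate-conjugate zero    c        N x = refl
    evaluate-conjugate (suc m) []       N x = sym (orbit-0 N)
    evaluate-conjugate (suc m) (c ∷ cs) N x = sym (begin
      _  ≈⟨ orbit-+ _ _ N ⟩
      _
        ≈⟨ +-cong (sym (evaluate-conjugate m c N (x ∘ suc)))
             (trans (orbit-* _ _ N) (*-congˡ (sym (evaluate-conjugate (suc m) cs N x)))) ⟩
      _  ∎)

    conjugate≈0 : ∀ m P N → AllCoefficients (_≈ 0#) m (conjugate m P N) → AllCoefficients (_≈ 0#) m P
    conjugate≈0 zero    c  N c≈0  = decidable-stable em λ c≉0 → orbit-≉0 N c≉0 c≈0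
    conjugate≈0 (suc m) cs N cs≈0 = All.map (λ {c} → conjugate≈0 m c N) (Allₚ.map⁻ cs≈0)

    -- For `position = toℕ` and the orbit of `a`, the function is σᴺ(P(t)); for other solutions it
    -- is the conjugate polynomial at their window starting at N. The positions are arbitrary
    -- because passing to coefficients drops the first variable.
    polynomial-represented : ∀ m P → AllCoefficients E m P → (position : Fin m → ℕ) →
      Represented (λ N A → evaluate m (conjugate m P N) (λ i → A (position i ℕ.+ N)))
    polynomial-represented zero    c        c∈E          _        = E-represented c∈E
    polynomial-represented (suc m) []       []           _        = represented-term 𝟎 λ _ _ _ → refl
    polynomial-represented (suc m) (c ∷ cs) (c∈E ∷ cs∈E) position = represented-+
      (polynomial-represented m c c∈E (position ∘ suc))
      (represented-* (represented-entry (position zero)) (polynomial-represented (suc m) cs cs∈E position))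

    independent : AlgebraicallyIndependent E t
    independent P P∈E P[t]≈0 with polynomial-represented n P P∈E toℕ
    ... | N , represented w W U w≉0 W≈ U≈ = conjugate≈0 n P N′ (vanishing-polynomial infinite n (conjugate n P N′) vanish)
      where
      N′ = N ℕ.+ 0
      atWindow : Sequence → Carrier
      atWindow A = evaluate n (conjugate n P N′) (λ i → A (toℕ i ℕ.+ N′))
      atWindow≈0 : atWindow (orbit σ a) ≈ 0#
      atWindow≈0 = begin
        atWindow (orbit σ a)
          ≈⟨ evaluate-cong n (conjugate n P N′) (λ i → reflexive (orbit-+ₙ σ a (toℕ i) N′)) ⟩
        evaluate n (conjugate n P N′) (λ i → orbit σ (t i) N′)     ≈⟨ evaluate-conjugate n P N′ t ⟩
        orbit σ (evaluate n P t) N′                                ≈⟨ orbit-cong N′ P[t]≈0 ⟩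
        orbit σ 0# N′                                              ≈⟨ orbit-0 N′ ⟩
        0#                                                         ∎
      U≈0 : ∀ A → ⟦ U ⟧ˢ ⟨ A , orbit σ b ⟩ 0 ≈ 0#
      U≈0 = generic U (trans (U≈ _ orbit-solution 0) (trans (*-congˡ atWindow≈0) (zeroʳ _)))
      extended : Vector Carrier n → ℕ → Carrier
      extended x i with i ℕₚ.<? n
      ... | yes i<n = x (Fin.fromℕ< i<n)
      ... | no  _   = 0#
      extended-toℕ : ∀ x i → extended x (toℕ i) ≡ x i
      extended-toℕ x i with toℕ i ℕₚ.<? n
      ... | yes i<n = ≡.cong x (Finₚ.fromℕ<-toℕ i i<n)
      ... | no  i≮n = contradiction (Finₚ.toℕ<n i) i≮n
      vanish : ∀ x → evaluate n (conjugate n P N′) x ≈ 0#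
      vanish x with solution-through N′ (extended x)
      -- `U` vanishes on every sequence, and on the solution through the window `x` it equals w
      -- times the conjugate polynomial at `x`.
      ... | A , solution , A≈ = trans
        (evaluate-cong n (conjugate n P N′) {x} λ i → sym (trans (A≈ (toℕ i) (Finₚ.toℕ<n i)) (reflexive (extended-toℕ x i))))
        (x*y≈0⇒y≈0 w≉0 (trans (sym (U≈ A solution 0)) (U≈0 A)))

    private
      -- This field contains the whole difference field generated by `a` over `E`, so algebraicity
      -- is witnessed by linear polynomials. It is closed under σ because σⁿ(a) = b a + c, and under
      -- σ⁻¹ because b ≠ 0 lets the same equation be solved for its lowest term.
      E[t] : Pred Carrier 0ℓ
      E[t] = subfield (E ∪ entries t)

      E⊆E[t] : ∀ {x} → E x → E[t] x
      E⊆E[t] = gen ∘ inj₁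

      b∈E : E b
      b∈E = gen (zero , refl)

      c∈E : E c
      c∈E = gen (suc zero , refl)

      a∈E[t] : E[t] a
      a∈E[t] = gen (inj₂ (zero , refl))

      orbit∈E[t] : ∀ i → i ℕ.≤ n → E[t] (orbit σ a i)
      orbit∈E[t] i i≤n with ℕₚ.m≤n⇒m<n∨m≡n i≤n
      ... | inj₁ i<n = gen (inj₂ (Fin.fromℕ< i<n , reflexive (≡.cong (orbit σ a) (≡.sym (Finₚ.toℕ-fromℕ< i<n)))))
      ... | inj₂ ≡.refl = resp (sym σⁿa≈ba+c) (+∈ (*∈ (E⊆E[t] b∈E) a∈E[t]) (E⊆E[t] c∈E))

      σ-⁻¹ : ∀ {x} → ¬ x ≈ 0# → σ x ⁻¹ ≈ σ (x ⁻¹)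
      σ-⁻¹ {x} x≉0 = *-cancelʳ (σ-≉0 x≉0) (begin
        σ x ⁻¹ * σ x      ≈⟨ *-comm _ _ ⟩
        σ x * σ x ⁻¹      ≈⟨ *-inverse (σ x) (σ-≉0 x≉0) ⟩
        1#                ≈⟨ σ-1 ⟨
        σ 1#              ≈⟨ σ-cong (trans (*-comm _ _) (*-inverse x x≉0)) ⟨
        σ (x ⁻¹ * x)      ≈⟨ σ-* (x ⁻¹) x ⟩
        σ (x ⁻¹) * σ x    ∎)

      σ∈E[t] : ∀ {x} → E[t] x → E[t] (σ x)
      σ∈E[t] (gen (inj₁ x∈E)) = E⊆E[t] (step (inj₁ refl) x∈E)
      σ∈E[t] (gen (inj₂ (i , x≈tᵢ))) =
        resp (trans (reflexive (≡.sym (orbit-suc σ a (toℕ i)))) (σ-cong (sym x≈tᵢ))) (orbit∈E[t] (suc (toℕ i)) (Finₚ.toℕ<n i))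
      σ∈E[t] (resp x≈y x∈) = resp (σ-cong x≈y) (σ∈E[t] x∈)
      σ∈E[t] 0∈ = resp (sym σ-0) 0∈
      σ∈E[t] 1∈ = resp (sym σ-1) 1∈
      σ∈E[t] (+∈ {x} {y} x∈ y∈) = resp (sym (σ-+ x y)) (+∈ (σ∈E[t] x∈) (σ∈E[t] y∈))
      σ∈E[t] (-∈ {x} x∈) = resp (sym (σ-neg x)) (-∈ (σ∈E[t] x∈))
      σ∈E[t] (*∈ {x} {y} x∈ y∈) = resp (sym (σ-* x y)) (*∈ (σ∈E[t] x∈) (σ∈E[t] y∈))
      σ∈E[t] (⁻¹∈ x≉0 x∈) = resp (σ-⁻¹ x≉0) (⁻¹∈ (σ-≉0 x≉0) (σ∈E[t] x∈))

      Preimage : Pred Carrier 0ℓ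
      Preimage x = ∃ λ y → E[t] y × σ y ≈ x

      E-preimage : ∀ {x} → E x → ∃ λ y → E y × σ y ≈ x
      E-preimage {x} x∈E with σ-surjective x
      ... | y , σy≈x = y , step (inj₂ (sym σy≈x)) x∈E , σy≈x

      -- Applying σ⁻¹ to b a = σⁿ(a) - c gives σ⁻¹(a) = (σⁿ⁻¹(a) - σ⁻¹(c)) / σ⁻¹(b).
      a-preimage : Preimage a
      a-preimage with E-preimage b∈E | E-preimage c∈E
      ... | b′ , b′∈E , σb′≈b | c′ , c′∈E , σc′≈c =
        b′ ⁻¹ * (orbit σ a n-1 - c′) ,
        *∈ (⁻¹∈ b′≉0 (E⊆E[t] b′∈E)) (+∈ (orbit∈E[t] n-1 (ℕₚ.n≤1+n n-1)) (-∈ (E⊆E[t] c′∈E))) ,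
        (begin
          σ (b′ ⁻¹ * (orbit σ a n-1 - c′))        ≈⟨ σ-* _ _ ⟩
          σ (b′ ⁻¹) * σ (orbit σ a n-1 - c′)
            ≈⟨ *-congˡ (trans (σ-+ _ _) (+-cong (reflexive (orbit-suc σ a n-1)) (trans (σ-neg c′) (-‿cong σc′≈c)))) ⟩
          σ (b′ ⁻¹) * (orbit σ a n - c)           ≈⟨ *-congˡ (+-congʳ (trans σⁿa≈ba+c (+-comm _ _))) ⟩
          σ (b′ ⁻¹) * (c + b * a - c)             ≈⟨ *-congˡ (xyx⁻¹≈y c (b * a)) ⟩
          σ (b′ ⁻¹) * (b * a)                     ≈⟨ *-congˡ (*-congʳ σb′≈b) ⟨
          σ (b′ ⁻¹) * (σ b′ * a)                  ≈⟨ *-assoc _ _ _ ⟨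
          σ (b′ ⁻¹) * σ b′ * a                    ≈⟨ *-congʳ (σ-* _ _) ⟨
          σ (b′ ⁻¹ * b′) * a
            ≈⟨ *-congʳ (trans (σ-cong (trans (*-comm _ _) (*-inverse b′ b′≉0))) σ-1) ⟩
          1# * a                                  ≈⟨ *-identityˡ a ⟩
          a                                       ∎)
        where
        b′≉0 : ¬ b′ ≈ 0#
        b′≉0 b′≈0 = b≉0 (trans (sym σb′≈b) (trans (σ-cong b′≈0) σ-0))

      preimage : ∀ {x} → E[t] x → Preimage x
      preimage (gen (inj₁ x∈E)) with E-preimage x∈E
      ... | y , y∈E , σy≈x = y , E⊆E[t] y∈E , σy≈x
      preimage (gen (inj₂ (zero , x≈a))) with a-preimage
      ... | y , y∈ , σy≈a = y , y∈ , trans σy≈a (sym x≈a)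
      preimage (gen (inj₂ (suc i , x≈t))) = orbit σ a (toℕ i) , orbit∈E[t] (toℕ i) (ℕₚ.<⇒≤ (ℕₚ.m≤n⇒m≤1+n (Finₚ.toℕ<n i))) ,
        trans (reflexive (orbit-suc σ a (toℕ i))) (sym x≈t)
      preimage (resp x≈y x∈) with preimage x∈
      ... | u , u∈ , σu≈x = u , u∈ , trans σu≈x x≈y
      preimage 0∈ = 0# , 0∈ , σ-0
      preimage 1∈ = 1# , 1∈ , σ-1
      preimage (+∈ x∈ y∈) with preimage x∈ | preimage y∈
      ... | u , u∈ , σu≈x | v , v∈ , σv≈y = u + v , +∈ u∈ v∈ , trans (σ-+ u v) (+-cong σu≈x σv≈y)
      preimage (-∈ x∈) with preimage x∈
      ... | u , u∈ , σu≈x = - u , -∈ u∈ , trans (σ-neg u) (-‿cong σu≈x)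
      preimage (*∈ x∈ y∈) with preimage x∈ | preimage y∈
      ... | u , u∈ , σu≈x | v , v∈ , σv≈y = u * v , *∈ u∈ v∈ , trans (σ-* u v) (*-cong σu≈x σv≈y)
      preimage (⁻¹∈ {x} x≉0 x∈) with preimage x∈
      ... | u , u∈ , σu≈x = u ⁻¹ , ⁻¹∈ u≉0 u∈ , *-cancelʳ x≉0 (begin
        σ (u ⁻¹) * x       ≈⟨ *-congˡ σu≈x ⟨
        σ (u ⁻¹) * σ u     ≈⟨ σ-* _ _ ⟨
        σ (u ⁻¹ * u)       ≈⟨ trans (σ-cong (trans (*-comm _ _) (*-inverse u u≉0))) σ-1 ⟩
        1#                 ≈⟨ trans (*-comm _ _) (*-inverse x x≉0) ⟨
        x ⁻¹ * x           ∎)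
        where
        u≉0 : ¬ u ≈ 0#
        u≉0 u≈0 = x≉0 (trans (sym σu≈x) (trans (σ-cong u≈0) σ-0))

      generated⊆E[t] : ∀ {x} → differenceSubfield (E ∪ entries (a Vector.∷ Vector.[])) x → E[t] x
      generated⊆E[t] (gen (inj₁ x∈E))          = E⊆E[t] x∈E
      generated⊆E[t] (gen (inj₂ (zero , x≈a))) = gen (inj₂ (zero , x≈a))
      generated⊆E[t] (resp x≈y x∈)             = resp x≈y (generated⊆E[t] x∈)
      generated⊆E[t] 0∈                        = 0∈
      generated⊆E[t] 1∈                        = 1∈
      generated⊆E[t] (+∈ x∈ y∈)                = +∈ (generated⊆E[t] x∈) (generated⊆E[t] y∈)
      generated⊆E[t] (-∈ x∈)                   = -∈ (generated⊆E[t] x∈)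
      generated⊆E[t] (*∈ x∈ y∈)                = *∈ (generated⊆E[t] x∈) (generated⊆E[t] y∈)
      generated⊆E[t] (⁻¹∈ x≉0 x∈)              = ⁻¹∈ x≉0 (generated⊆E[t] x∈)
      generated⊆E[t] (step (inj₁ y≈σx) x∈)     = resp (sym y≈σx) (σ∈E[t] (generated⊆E[t] x∈))
      generated⊆E[t] (step (inj₂ x≈σy) x∈) with preimage (generated⊆E[t] x∈)
      ... | u , u∈ , σu≈x = resp (σ-injective em (trans σu≈x x≈σy)) u∈

      algebraic : ∀ {x} → E[t] x → AlgebraicOver E[t] x
      algebraic {x} x∈ = - x ∷ 1# ∷ [] , -∈ x∈ ∷ 1∈ ∷ [] , (λ { (_ ∷ 1≈0 ∷ []) → 0≉1 (sym 1≈0) }) , (begin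
        - x + x * (1# + x * 0#)  ≈⟨ +-congˡ (*-congˡ (trans (+-congˡ (zeroʳ x)) (+-identityʳ 1#))) ⟩
        - x + x * 1#             ≈⟨ +-congˡ (*-identityʳ x) ⟩
        - x + x                  ≈⟨ -‿inverseˡ x ⟩
        0#                       ∎)

      t∈generated : ∀ i → differenceSubfield (E ∪ entries (a Vector.∷ Vector.[])) (orbit σ a i)
      t∈generated zero    = gen (inj₂ (zero , refl))
      t∈generated (suc i) = resp (reflexive (orbit-suc σ a i)) (step (inj₁ refl) (t∈generated i))

    degσ≡n : degσ[ a Vector.∷ Vector.[] / parameters ]≡ n
    degσ≡n = t , t∈generated ∘ toℕ , independent , λ x → algebraic ∘ generated⊆E[t]

    open σSemantics M using (_∈dcl_; ⟦_⟧)

    ⟦σ^⟧ : ∀ {v} i (s : σTerm v) ρ → ⟦ σ^ i s ⟧ ρ ≡ orbit σ (⟦ s ⟧ ρ) i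
    ⟦σ^⟧ zero    s ρ = ≡.refl
    ⟦σ^⟧ (suc i) s ρ = ⟦σ^⟧ i σ⟨ s ⟩ ρ

    -- Two solutions of the affine equation differ by a solution of the homogeneous one.
    definable : (∀ y → orbit σ y n ≈ b * y → y ≈ 0#) → a ∈dcl parameters
    definable nonquotient = φ , trans (reflexive (⟦σ^⟧ n (var zero) _)) σⁿa≈ba+c , λ a′ σⁿa′≈ba′+c →
      x∙y⁻¹≈ε⇒x≈y a′ a (nonquotient (a′ - a) (begin
        orbit σ (a′ - a) n                    ≈⟨ trans (orbit-+ a′ (- a) n) (+-congˡ (orbit-neg a n)) ⟩
        orbit σ a′ n - orbit σ a n
          ≈⟨ +-cong (trans (reflexive (≡.sym (⟦σ^⟧ n (var zero) (a′ Vector.∷ parameters)))) σⁿa′≈ba′+c) (-‿cong σⁿa≈ba+c) ⟩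
        b * a′ + c - (b * a + c)              ≈⟨ +-congˡ (⁻¹-∙-comm (b * a) c) ⟨
        b * a′ + c + (- (b * a) + - c)
          ≈⟨ solve 4 (λ x y x̄ ȳ → x :+ y :+ (x̄ :+ ȳ) := x :+ x̄ :+ (y :+ ȳ)) refl (b * a′) c (- (b * a)) (- c) ⟩
        b * a′ - b * a + (c - c)              ≈⟨ trans (+-congˡ (-‿inverseʳ c)) (+-identityʳ _) ⟩
        b * a′ - b * a                        ≈⟨ x[y-z]≈xy-xz b a′ a ⟨
        b * (a′ - a)                          ∎))
      where
      open import Algebra.Properties.Ring ring using (x[y-z]≈xy-xz) renaming (-‿+-comm to ⁻¹-∙-comm)
      φ : σFormula 3
      φ = σ^ n (var zero) ≐ (var (suc zero) ⊗ var zero ⊕ var (suc (suc zero)))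

-- The ultraproduct

-- The stored proof is irrelevant, but primality is decidable and so can be recomputed.
isPrime : (p : ℙ) → Prime (value p)
isPrime (p , [ p-prime ]) = recompute (prime? p) p-prime

n<m^n : ∀ m n → 1 ℕ.< m → n ℕ.< m ℕ.^ n
n<m^n m zero    1<m = s≤s z≤n
n<m^n m (suc n) 1<m = ℕₚ.≤-<-trans (n<m^n m n 1<m) (ℕₚ.^-monoʳ-< m 1<m (ℕₚ.n<1+n n))

module Construction (em : ExcludedMiddle 0ℓ) (ultrafilterLemma : UltrafilterLemma)
  (ℝ : CompleteOrderedField) (𝒟 : CountingData ℝ) (n-1 : ℕ) where
  open CompleteOrderedFieldProperties ℝ using (archimedean; ⌜⌝-mono)
  open CountingData 𝒟 using (f)
  private module ℝ = CompleteOrderedField ℝ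

  n : ℕ
  n = suc n-1

  module Local (p : ℙ) where
    private
      P = value p
      instance
        _ = prime⇒nonZero (isPrime p)
        _ = prime⇒nonTrivial (isPrime p)

    -- A finite list with all terms of length at most `P`, so any fixed term belongs to it once the
    -- prime is large.
    terms : List (σTerm 2)
    terms = termsOfDepth≤ P 2

    nongeneric : ℕ
    nongeneric = length terms ℕ.* P ℕ.^ P

    -- Since m < 2 ^ m, this exceeds both f(p , p) and the number of points that genericity may
    -- exclude; the field has more than `k` elements.
    k : ℕ
    k = 2 ℕ.^ (nongeneric ℕ.⊔ proj₁ (archimedean em (f P P)))

    private
      exponent≤k : nongeneric ℕ.⊔ proj₁ (archimedean em (f P P)) ℕ.≤ k
      exponent≤k = ℕₚ.<⇒≤ (n<m^n 2 _ (s≤s (s≤s z≤n)))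

    large : f P P ℝ.≤ ℝ.⌜ k ⌝
    large = IsTotalOrder.trans ℝ.isTotalOrder (proj₂ (archimedean em (f P P)))
      (⌜⌝-mono (ℕₚ.≤-trans (ℕₚ.m≤n⊔m nongeneric _) exponent≤k))

    open FiniteField (finiteField em (isPrime p) (nongeneric ℕ.⊔ proj₁ (archimedean em (f P P)))) public
      renaming (baseField to 𝔽)
    open FrobeniusOfFiniteField 𝔽 P (isPrime p) characteristic public
    open Field 𝔽 using (Carrier; _≈_; 0#; 1#; 0≉1; _*_; _^_; sym; setoid) public

    P≤q : P ℕ.≤ P ℕ.^ k
    P≤q = ≡.subst (ℕ._≤ P ℕ.^ k) (ℕₚ.*-identityʳ P) (ℕₚ.^-monoʳ-≤ P (ℕₚ.m^n>0 2 (nongeneric ℕ.⊔ proj₁ (archimedean em (f P P)))))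

    enumeration : Fin (P ℕ.^ k) → Carrier
    enumeration = Inverse.to cardinality

    enumeration-distinct : ∀ {i j} → ¬ i ≡ j → ¬ enumeration i ≈ enumeration j
    enumeration-distinct i≢j = i≢j ∘ FiniteSetoids.to-injective setoid cardinality

    twist : ∃ λ b → ¬ b ≈ 0# × (2 ℕ.< P → ∀ y → orbit (_^ P) y n ≈ b * y → y ≈ 0#)
    twist with 2 ℕₚ.<? P
    -- At p = 2, where 1 = -1, the value 1 is a placeholder; the ultrafilter contains the set of
    -- primes above 2.
    ... | no  2≮P = 1# , 0≉1 ∘ sym , flip contradiction 2≮P
    ... | yes 2<P = let b , b≉0 , nq = nonquotient cardinality em 2<P n in b , b≉0 , λ _ → nq

    b : Carrier
    b = proj₁ twist

    open FrobeniusGenericity em 𝔽 P public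

    generic-element : ∃ λ a → a ∈ tabulate enumeration × Generic (orbit (_^ P) b) (_∈ terms) a
    generic-element = generic-exists (orbit (_^ P) b) terms (tabulate enumeration)
      (AllPairsₚ.tabulate⁺ enumeration-distinct)
      (≡.subst (nongeneric ℕ.<_) (≡.sym (Listₚ.length-tabulate enumeration))
        (ℕₚ.≤-<-trans (ℕₚ.≤-trans (ℕₚ.m≤m⊔n nongeneric _) exponent≤k) (n<m^n P k (ℕ.nonTrivial⇒n>1 P))))

    a : Carrier
    a = proj₁ generic-element

  𝓤,isUltrafilter,cofinite⊆𝓤 = ultrafilterLemma Cofinite cofinite-isFilter
  isUltrafilter = proj₁ (proj₂ 𝓤,isUltrafilter,cofinite⊆𝓤)
  open IsUltrafilter isUltrafilter

  𝔖 : 𝒮 𝒟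
  𝔖 = record
    { 𝓤             = proj₁ 𝓤,isUltrafilter,cofinite⊆𝓤
    ; isUltrafilter = isUltrafilter
    ; nonPrincipal  = cofinite⊆⇒nonprincipal (proj₂ (proj₂ 𝓤,isUltrafilter,cofinite⊆𝓤))
    ; k             = Local.k
    ; large         = Local.large
    ; 𝔽             = Local.𝔽
    ; cardinality   = Local.cardinality
    }

  M : σField
  M = 𝒮.structure 𝔖

  open σField M hiding (zero)
  private 𝓤 = 𝒮.𝓤 𝔖

  eventually : ∀ {A : Pred ℙ 0ℓ} N → (∀ p → N ℕ.< value p → A p) → 𝓤 A
  eventually N h = proj₂ (proj₂ 𝓤,isUltrafilter,cofinite⊆𝓤) (N , h)

  always : ∀ {A : Pred ℙ 0ℓ} → (∀ p → A p) → 𝓤 A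
  always h = eventually 0 λ p _ → h p

  a b : Carrier
  a = Local.a
  b = Local.b

  automorphism : DifferenceFields.IsAutomorphism M
  automorphism = record
    { σ-+          = λ x y → always λ p → Auto.σ-+ p (x p) (y p)
    ; σ-*          = λ x y → always λ p → Auto.σ-* p (x p) (y p)
    ; σ-1          = always Auto.σ-1
    ; σ-surjective = λ y → (λ p → proj₁ (Auto.σ-surjective p (y p))) , always λ p → proj₂ (Auto.σ-surjective p (y p))
    }
    where
    module Auto p = DifferenceFields.IsAutomorphism (Local.frobenius-isAutomorphism p (Local.cardinality p) em)

  orbit-component : ∀ x i p → orbit σ x i p ≡ orbit (λ y → Field._^_ (Local.𝔽 p) y (value p)) (x p) i
  orbit-component x zero    p = ≡.refl
  orbit-component x (suc i) p = orbit-component (σ x) i p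

  module Seq (p : ℙ) = SequenceSemantics (Local.𝔽 p)
  open SequenceSemantics baseField

  -- Łoś's theorem for terms; ring operations and shift act coordinatewise, so it holds at every
  -- prime and not just almost everywhere.
  ⟦⟧ˢ-component : ∀ {v} p (t : σTerm v) {ρ ρ′} → (∀ i j → ρ i j p ≡ ρ′ i j) → ∀ j → ⟦ t ⟧ˢ ρ j p ≡ Seq.⟦_⟧ˢ p t ρ′ j
  ⟦⟧ˢ-component p (var i)  ρ≡ j = ρ≡ i j
  ⟦⟧ˢ-component p 𝟎        ρ≡ j = ≡.refl
  ⟦⟧ˢ-component p 𝟏        ρ≡ j = ≡.refl
  ⟦⟧ˢ-component p (⊖ t)    ρ≡ j = ≡.cong (Field.-_ (Local.𝔽 p)) (⟦⟧ˢ-component p t ρ≡ j)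
  ⟦⟧ˢ-component p σ⟨ t ⟩   ρ≡ j = ⟦⟧ˢ-component p t ρ≡ (suc j)
  ⟦⟧ˢ-component p (s ⊕ t)  ρ≡ j = ≡.cong₂ (Field._+_ (Local.𝔽 p)) (⟦⟧ˢ-component p s ρ≡ j) (⟦⟧ˢ-component p t ρ≡ j)
  ⟦⟧ˢ-component p (s ⊗ t)  ρ≡ j = ≡.cong₂ (Field._*_ (Local.𝔽 p)) (⟦⟧ˢ-component p s ρ≡ j) (⟦⟧ˢ-component p t ρ≡ j)

  -- At all primes above twice the length of `t`, the term was among those that the local choice of
  -- `a` took into account.
  generic : ∀ t → ⟦ t ⟧ˢ ⟨ orbit σ a , orbit σ b ⟩ 0 ≈ 0# → ∀ A → ⟦ t ⟧ˢ ⟨ A , orbit σ b ⟩ 0 ≈ 0#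
  generic t t[a]≈0 A = upward
    (λ {p} (e , 2∣t∣<p) → ≡.subst (λ x → Field._≈_ (Local.𝔽 p) x (Field.0# (Local.𝔽 p)))
      (≡.sym (⟦⟧ˢ-component p t (λ { zero j → ≡.refl ; (suc zero) j → orbit-component b j p }) 0))
      (proj₂ (proj₂ (Local.generic-element p)) t (∈-termsOfDepth≤ (value p) t (ℕₚ.≤-trans (ℕₚ.m≤m+n _ _) (ℕₚ.<⇒≤ 2∣t∣<p)))
        (ℕₚ.<⇒≤ 2∣t∣<p)
        (≡.subst (λ x → Field._≈_ (Local.𝔽 p) x (Field.0# (Local.𝔽 p)))
          (⟦⟧ˢ-component p t (λ { zero j → orbit-component a j p ; (suc zero) j → orbit-component b j p }) 0) e)
        (λ i → A i p)))
    (meet t[a]≈0 (eventually (∣ t ∣ᵗ ℕ.+ ∣ t ∣ᵗ) λ p l → l))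

  infinite : ∀ L → ∃ λ xs → UnivariatePolynomials.Distinct baseField xs × L ℕ.≤ length xs
  infinite L = tabulate e , AllPairsₚ.tabulate⁺ e-distinct , ℕₚ.≤-reflexive (≡.sym (Listₚ.length-tabulate e))
    where
    e : Fin L → Carrier
    e i p with toℕ i ℕₚ.<? value p ℕ.^ Local.k p
    ... | yes i<q = Local.enumeration p (Fin.fromℕ< i<q)
    -- A filler for fields with too few elements, which cannot occur once p > L because the field
    -- has at least p elements.
    ... | no  _   = 0# p
    e-distinct : ∀ {i j} → ¬ i ≡ j → ¬ e i ≈ e j
    e-distinct {i} {j} i≢j eᵢ≈eⱼ = proper (upward (λ {p} (e , L<p) → distinct p L<p e) (meet eᵢ≈eⱼ (eventually L λ p l → l)))
      where
      distinct : ∀ p → L ℕ.< value p → ¬ Field._≈_ (Local.𝔽 p) (e i p) (e j p)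
      distinct p L<p with toℕ i ℕₚ.<? value p ℕ.^ Local.k p | toℕ j ℕₚ.<? value p ℕ.^ Local.k p
      ... | yes i<q | yes j<q = Local.enumeration-distinct p λ i≡j → i≢j (Finₚ.toℕ-injective
        (≡.trans (≡.sym (Finₚ.toℕ-fromℕ< i<q)) (≡.trans (≡.cong toℕ i≡j) (Finₚ.toℕ-fromℕ< j<q))))
      ... | no  i≮q | _       = contradiction (ℕₚ.<-≤-trans (ℕₚ.<-trans (Finₚ.toℕ<n i) L<p) (Local.P≤q p)) i≮q
      ... | yes _   | no  j≮q = contradiction (ℕₚ.<-≤-trans (ℕₚ.<-trans (Finₚ.toℕ<n j) L<p) (Local.P≤q p)) j≮q

  b≉0 : ¬ b ≈ 0#
  b≉0 b≈0 = proper (upward (λ {p} → proj₁ (proj₂ (Local.twist p))) b≈0)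

  nonquotientᵁ : ∀ y → orbit σ y n ≈ b * y → y ≈ 0#
  nonquotientᵁ y e = upward
    (λ {p} (e , 2<p) → proj₂ (proj₂ (Local.twist p)) 2<p (y p)
      (≡.subst (λ x → Field._≈_ (Local.𝔽 p) x (Field._*_ (Local.𝔽 p) (b p) (y p))) (orbit-component y n p) e))
    (meet e (eventually 2 λ p l → l))

  open AffineDifferenceEquation em M automorphism infinite n-1 using (module Solution)
  open Solution a b b≉0 generic public using (parameters; definable; degσ≡n)

open import Data.Vec.Functional using (_∷_; [])

theorem4p6 : ExcludedMiddle 0ℓ → UltrafilterLemma →
    (ℝ : CompleteOrderedField) (𝒟 : CountingData ℝ) →
    (n : ℕ) → n > 0 →
    Σ (𝒮 𝒟) λ 𝔖 → let F = 𝒮.structure 𝔖 in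
    Σ (σField.Carrier F) λ a → Σ ℕ λ m → Σ (Vector (σField.Carrier F) m) λ b →
    σSemantics._∈dcl_ F a b × DifferenceAlgebra.degσ[_/_]≡_ F (a ∷ []) b n
theorem4p6 em ultrafilterLemma ℝ 𝒟 (suc n-1) _ = 𝔖 , a , 2 , parameters , definable nonquotientᵁ , degσ≡n
  where open Construction em ultrafilterLemma ℝ 𝒟 n-1
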